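{- Let $k\geq 1$ and let $K^{ -1}(P_k)$ denote the unique (up to isomorphism) graph $H\in\mathcal{T}$ whose clique graph $K(H)$ is isomorphic to the path $P_k$. If $G\in\mathcal{T}$ has the same adjacency spectrum (with multiplicities) as $K^{ -1}(P_k)$, then $G$ is isomorphic to $K^{ -1}(P_k)$.
   Context: Graphs are finite, simple and undirected. $T$ denotes the triangle $K_3$ and $P_k$ the path on $k$ vertices. The set $\mathcal{T}$ is defined recursively: $T\in\mathcal{T}$, and if $H\in\mathcal{T}$, then the graph obtained by identifying a vertex of degree $2$ of $H$ with a vertex of a new (disjoint) copy of $T$ belongs to $\mathcal{T}$. The clique graph $K(G)$ has as vertices the maximal complete subgraphs of $G$, two of them adjacent iff they share at least one vertex. -}

module Defs where

open import Data.Nat using (ℕ; zero; suc)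
open import Data.Bool using (Bool; true; false; if_then_else_)
open import Data.Fin using (Fin; zero; suc; toℕ; punchIn; _≟_)
open import Data.Fin.Subset using (Subset; _∈_; _⊆_)
open import Data.Integer using (ℤ; +_; _-_; _*_; _+_; -_)
open import Data.Product using (Σ; _×_; ∃; ∃-syntax)
open import Data.Sum using (_⊎_)
open import Function.Bundles using (_↔_; Inverse)
open import Relation.Binary.PropositionalEquality using (_≡_; _≢_)
open import Relation.Nullary.Decidable using (⌊_⌋)

-- A graph on vertex set Fin n is given by a Boolean adjacency function.
-- (Simplicity -- symmetry and irreflexivity -- is automatic for members of 𝒯.)
Adj : ℕ → Set
Adj n = Fin n → Fin n → Bool

_≅_ : ∀ {n m} → Adj n → Adj m → Set
_≅_ {n} {m} A B = Σ (Fin n ↔ Fin m) λ f →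
  ∀ u v → B (Inverse.to f u) (Inverse.to f v) ≡ A u v

sumFin : ∀ {n} → (Fin n → ℕ) → ℕ
sumFin {zero} f = 0
sumFin {suc n} f = f zero Data.Nat.+ sumFin (λ i → f (suc i))

b2n : Bool → ℕ
b2n true = 1
b2n false = 0

deg : ∀ {n} → Adj n → Fin n → ℕ
deg A v = sumFin (λ u → b2n (A v u))

triangle : Adj 3
triangle u v = if ⌊ u ≟ v ⌋ then false else true

-- Glue a new triangle at vertex v: the new vertices are 0 and 1,
-- old vertex u becomes suc (suc u); the new triangle is {0, 1, v}.
glue : ∀ {n} → Adj n → Fin n → Adj (suc (suc n))
glue A v zero zero = false
glue A v zero (suc zero) = true
glue A v (suc zero) zero = true
glue A v (suc zero) (suc zero) = false
glue A v zero (suc (suc w)) = ⌊ w ≟ v ⌋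
glue A v (suc zero) (suc (suc w)) = ⌊ w ≟ v ⌋
glue A v (suc (suc u)) zero = ⌊ u ≟ v ⌋
glue A v (suc (suc u)) (suc zero) = ⌊ u ≟ v ⌋
glue A v (suc (suc u)) (suc (suc w)) = A u w

data Built : (n : ℕ) → Adj n → Set where
  base : Built 3 triangle
  step : ∀ {n} {A : Adj n} → Built n A → (v : Fin n) → deg A v ≡ 2 →
         Built (suc (suc n)) (glue A v)

In𝒯 : (n : ℕ) → Adj n → Set
In𝒯 n A = ∃[ m ] Σ (Adj m) λ B → Built m B × (B ≅ A)

IsClique : ∀ {n} → Adj n → Subset n → Set
IsClique A S = ∀ u v → u ∈ S → v ∈ S → u ≢ v → A u v ≡ true

IsMaxClique : ∀ {n} → Adj n → Subset n → Set
IsMaxClique {n} A S = IsClique A S × (∀ (S' : Subset n) → IsClique A S' → S ⊆ S' → S' ⊆ S)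

PathAdj : ∀ {k} → Fin k → Fin k → Set
PathAdj i j = (toℕ j ≡ suc (toℕ i)) ⊎ (toℕ i ≡ suc (toℕ j))

CliqueGraphIsoPath : ∀ {n} → Adj n → ℕ → Set
CliqueGraphIsoPath {n} A k = Σ (Fin k → Subset n) λ f →
    (∀ i → IsMaxClique A (f i))
  × (∀ i j → f i ≡ f j → i ≡ j)
  × (∀ S → IsMaxClique A S → ∃[ i ] f i ≡ S)
  × (∀ i j → i ≢ j →
       ((∃[ u ] (u ∈ f i × u ∈ f j)) → PathAdj i j)
     × (PathAdj i j → ∃[ u ] (u ∈ f i × u ∈ f j)))

sumFinℤ : ∀ {n} → (Fin n → ℤ) → ℤ
sumFinℤ {zero} f = + 0
sumFinℤ {suc n} f = f zero + sumFinℤ (λ i → f (suc i))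

sgn : ℕ → ℤ
sgn zero = + 1
sgn (suc m) = - sgn m

det : ∀ n → (Fin n → Fin n → ℤ) → ℤ
det zero M = + 1
det (suc n) M = sumFinℤ λ j →
  sgn (toℕ j) * M zero j * det n (λ r c → M (suc r) (punchIn j c))

b2z : Bool → ℤ
b2z true = + 1
b2z false = + 0

charPoly : ∀ {n} → Adj n → ℤ → ℤ
charPoly {n} A t = det n λ i j → (if ⌊ i ≟ j ⌋ then t else + 0) - b2z (A i j)

-- Same adjacency spectrum (with multiplicities) = same characteristic polynomial.
Cospectral : ∀ {n m} → Adj n → Adj m → Set
Cospectral A B = ∀ t → charPoly A t ≡ charPoly B t

{-# OPTIONS --safe #-}

-- A member of 𝒯 with k triangles is the line graph of a tree S with k nodes of degree 3
-- and k + 2 leaves.  At t = ε - 2 its characteristic polynomial is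
-- -(|S| - ε W(S) + O(ε²)), where W is the Wiener index, so the spectrum determines k and
-- W(S).  Gluing a triangle at v increases W by 2 (σ(v) + |S|) + 2, where σ(v) is the sum
-- of the distances from v.  By induction W and σ are bounded by their values for the
-- caterpillar, and equality forces two leaves at distance k + 1, which only the
-- caterpillar has.  If K(H) is a path, then the tree of H is the caterpillar.
module Submission where

open import Defs
open import Data.Bool using (Bool; true; false; if_then_else_)
open import Data.Empty using (⊥; ⊥-elim)
open import Data.Fin using (Fin; zero; suc; toℕ; punchIn; _≟_)
open import Data.Fin.Permutation using (Permutation; permutation; _⟨$⟩ʳ_; _⟨$⟩ˡ_; inverseˡ; inverseʳ; flip; _∘ₚ_; lift₀; remove; punchIn-permute; ↔⇒≡)
import Data.Fin.Permutation as Perm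
open import Data.Fin.Properties using (punchInᵢ≢i; toℕ-injective; suc-injective)
open import Data.Fin.Subset using (Subset; _∈_; _⊆_)
open import Data.Integer using (ℤ; +_; _-_; _*_; _+_; -_; ∣_∣)
open import Data.Integer.Properties using (+-identityˡ; +-identityʳ; *-zeroʳ; *-identityˡ; *-assoc; *-distribˡ-+; *-cancelˡ-≡; pos-*; +-injective; neg-injective; abs-*; i-j≡0⇒i≡j; ∣i∣≡0⇒i≡0)
open import Data.Integer.Tactic.RingSolver using (solve-∀)
open import Data.Nat using (ℕ; zero; suc; _≤_; _<_; _≥_; s≤s; z≤n) renaming (_+_ to _+ⁿ_; _*_ to _*ⁿ_)
import Data.Nat.Properties as ℕ
open import Data.Product using (_,_; proj₁; proj₂; _×_; ∃-syntax)
open import Data.Sum using (_⊎_; inj₁; inj₂)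
open import Data.Vec using (lookup; tabulate)
open import Data.Vec.Properties using (lookup∘tabulate; []=⇒lookup; lookup⇒[]=)
open import Function.Base using (_∘_)
open import Relation.Binary.PropositionalEquality
open import Relation.Nullary.Decidable using (⌊_⌋; isYes≗does; yes; no)
open ≡-Reasoning

-- Sums and determinants

-- With N the incidence matrix of S, the line graph has adjacency matrix NᵀN - 2I, and NNᵀ is the
-- signless Laplacian of S, which for a bipartite graph has the spectrum of the Laplacian. As S has
-- one node more than it has edges, the characteristic polynomial at ε - 2 is the Laplacian
-- polynomial at ε divided by ε; for a tree the two lowest coefficients of the quotient are, up to
-- sign, the number of nodes and the Wiener index. Here this expansion is proved directly, along the
-- gluings. The obstacle is that a gluing at v brings in the minor without v, and a graph in 𝒯 minus
-- a vertex is never in 𝒯, its order being even. Integer weights on the vertices treat both graphs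
-- at once: every quantity involved is affine in each weight, so setting a weight to 0 has a
-- computable effect. The remainder of the expansion is only known as some integer for each integer
-- ε, so coefficients are separated by divisibility instead of by comparing polynomials.

sum-cong : ∀ {n} {f g : Fin n → ℤ} → (∀ i → f i ≡ g i) → sumFinℤ f ≡ sumFinℤ g
sum-cong {zero}  f≗g = refl
sum-cong {suc n} f≗g = cong₂ _+_ (f≗g zero) (sum-cong (f≗g ∘ suc))

sum-zero : ∀ {n} {f : Fin n → ℤ} → (∀ i → f i ≡ + 0) → sumFinℤ f ≡ + 0
sum-zero {zero}  f≗0 = refl
sum-zero {suc n} f≗0 = cong₂ _+_ (f≗0 zero) (sum-zero (f≗0 ∘ suc))

sum-+ : ∀ {n} (f g : Fin n → ℤ) → sumFinℤ (λ i → f i + g i) ≡ sumFinℤ f + sumFinℤ g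
sum-+ {zero}  f g = refl
sum-+ {suc n} f g = trans (cong (_+_ (f zero + g zero)) (sum-+ (f ∘ suc) (g ∘ suc))) (interchange (f zero) (g zero) (sumFinℤ (f ∘ suc)) (sumFinℤ (g ∘ suc)))
  where
  interchange : ∀ a b c d → a + b + (c + d) ≡ a + c + (b + d)
  interchange = solve-∀

*-sum : ∀ {n} c (f : Fin n → ℤ) → c * sumFinℤ f ≡ sumFinℤ (λ i → c * f i)
*-sum {zero}  c f = *-zeroʳ c
*-sum {suc n} c f = trans (*-distribˡ-+ c (f zero) _) (cong (_+_ (c * f zero)) (*-sum c (f ∘ suc)))

sum-swap : ∀ {m n} (f : Fin m → Fin n → ℤ) →
           sumFinℤ (λ i → sumFinℤ (f i)) ≡ sumFinℤ (λ j → sumFinℤ (λ i → f i j))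
sum-swap {zero} {n} f = sym (sum-zero {n} {λ _ → + 0} (λ _ → refl))
sum-swap {suc m} f = trans (cong (_+_ (sumFinℤ (f zero))) (sum-swap (f ∘ suc)))
  (sym (sum-+ (f zero) (λ j → sumFinℤ (λ i → f (suc i) j))))

sum-single : ∀ {n} {f : Fin n → ℤ} v → (∀ j → j ≢ v → f j ≡ + 0) → sumFinℤ f ≡ f v
sum-single {f = f} zero f≗0 =
  trans (cong (_+_ (f zero)) (sum-zero (λ i → f≗0 (suc i) λ ()))) (+-identityʳ _)
sum-single (suc v) f≗0 =
  trans (cong₂ _+_ (f≗0 zero λ ()) (sum-single v (λ j j≢v → f≗0 (suc j) λ { refl → j≢v refl }))) (+-identityˡ _)

≟-refl : ∀ {n} (v : Fin n) → ⌊ v ≟ v ⌋ ≡ true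
≟-refl v with v ≟ v
... | yes _  = refl
... | no v≢v = ⊥-elim (v≢v refl)

≟-≢ : ∀ {n} {u v : Fin n} → u ≢ v → ⌊ u ≟ v ⌋ ≡ false
≟-≢ {u = u} {v} u≢v with u ≟ v
... | yes u≡v = ⊥-elim (u≢v u≡v)
... | no _    = refl

≟-sym : ∀ {n} (u v : Fin n) → ⌊ u ≟ v ⌋ ≡ ⌊ v ≟ u ⌋
≟-sym u v with u ≟ v
... | yes refl = sym (≟-refl u)
... | no u≢v   = sym (≟-≢ (u≢v ∘ sym))

≟-suc : ∀ {n} (u v : Fin n) → ⌊ suc u ≟ suc v ⌋ ≡ ⌊ u ≟ v ⌋
≟-suc u v = trans (isYes≗does (suc u ≟ suc v)) (sym (isYes≗does (u ≟ v)))

δ : ∀ {n} → Fin n → Fin n → ℤ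
δ u v = b2z ⌊ u ≟ v ⌋

δ-refl : ∀ {n} (v : Fin n) → δ v v ≡ + 1
δ-refl v = cong b2z (≟-refl v)

δ-≢ : ∀ {n} {u v : Fin n} → u ≢ v → δ u v ≡ + 0
δ-≢ u≢v = cong b2z (≟-≢ u≢v)

sgn² : ∀ m → sgn m * sgn m ≡ + 1
sgn² zero    = refl
sgn² (suc m) = trans (neg² (sgn m)) (sgn² m)
  where
  neg² : ∀ a → (- a) * (- a) ≡ a * a
  neg² = solve-∀

Matrix : ℕ → Set
Matrix n = Fin n → Fin n → ℤ

det-cong : ∀ n (M N : Matrix n) → (∀ i j → M i j ≡ N i j) → det n M ≡ det n N
det-cong zero    M N M≗N = refl
det-cong (suc n) M N M≗N = sum-cong λ j →
  cong₂ (λ x y → sgn (toℕ j) * x * y) (M≗N zero j) (det-cong n _ _ λ r c → M≗N (suc r) (punchIn j c))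

-- Apart from the corner term, every minor of the row expansion still contains column zero.
-- Expanding it there by induction gives a double sum over a removed row and a removed column whose
-- terms are symmetric in the two, so the order of summation can be exchanged.
det-column : ∀ n (M : Matrix (suc n)) →
  det (suc n) M ≡ sumFinℤ λ i → sgn (toℕ i) * M i zero * det n (λ r c → M (punchIn i r) (suc c))
det-column zero    M = refl
det-column (suc n) M = cong (_+_ (sgn 0 * M zero zero * det (suc n) (λ r c → M (suc r) (suc c)))) (begin
  sumFinℤ (λ j → sgn (suc (toℕ j)) * M zero (suc j) * det (suc n) (λ r c → M (suc r) (punchIn (suc j) c)))
    ≡⟨ sum-cong (λ j → trans
         (cong (sgn (suc (toℕ j)) * M zero (suc j) *_) (det-column n (λ r c → M (suc r) (punchIn (suc j) c))))
         (*-sum (sgn (suc (toℕ j)) * M zero (suc j)) (λ i → sgn (toℕ i) * M (suc i) zero * minor i j))) ⟩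
  sumFinℤ (λ j → sumFinℤ λ i →
    sgn (suc (toℕ j)) * M zero (suc j) * (sgn (toℕ i) * M (suc i) zero * minor i j))
    ≡⟨ sum-cong (λ j → sum-cong λ i → exchange (sgn (toℕ j)) (M zero (suc j)) (sgn (toℕ i)) (M (suc i) zero) (minor i j)) ⟩
  sumFinℤ (λ j → sumFinℤ λ i →
    sgn (suc (toℕ i)) * M (suc i) zero * (sgn (toℕ j) * M zero (suc j) * minor i j))
    ≡⟨ sum-swap (λ j i → sgn (suc (toℕ i)) * M (suc i) zero * (sgn (toℕ j) * M zero (suc j) * minor i j)) ⟩
  sumFinℤ (λ i → sumFinℤ λ j →
    sgn (suc (toℕ i)) * M (suc i) zero * (sgn (toℕ j) * M zero (suc j) * minor i j))
    ≡⟨ sum-cong (λ i → sym (*-sum (sgn (suc (toℕ i)) * M (suc i) zero) (λ j → sgn (toℕ j) * M zero (suc j) * minor i j))) ⟩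
  sumFinℤ (λ i → sgn (suc (toℕ i)) * M (suc i) zero * det (suc n) (λ r c → M (punchIn (suc i) r) (suc c))) ∎)
  where
  minor : Fin (suc n) → Fin (suc n) → ℤ
  minor i j = det n (λ r c → M (suc (punchIn i r)) (suc (punchIn j c)))

  exchange : ∀ s a t b d → (- s) * a * (t * b * d) ≡ (- t) * b * (s * a * d)
  exchange = solve-∀

det-transpose : ∀ n (M : Matrix n) → det n (λ r c → M c r) ≡ det n M
det-transpose zero    M = refl
det-transpose (suc n) M = sym (trans (det-column n M) (sum-cong λ i →
  cong (sgn (toℕ i) * M i zero *_) (sym (det-transpose n (λ r c → M (punchIn i r) (suc c))))))

swap01 : ∀ {n} → Fin (suc (suc n)) → Fin (suc (suc n))
swap01 zero          = suc zero
swap01 (suc zero)    = zero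
swap01 (suc (suc i)) = suc (suc i)

-- Expansion along the column keeps both swapped rows in all minors but two. Those two trade places
-- with opposite signs; in every other minor the swap again concerns the first two rows (`lower`),
-- so induction applies.
det-swap01 : ∀ n (M : Matrix (suc (suc n))) → det (suc (suc n)) (λ r c → M (swap01 r) c) ≡ - det (suc (suc n)) M
det-swap01 n M = begin
  det (suc (suc n)) M′
    ≡⟨ det-column (suc n) M′ ⟩
  + 1 * M (suc zero) zero * det (suc n) (λ r c → M′ (suc r) (suc c)) +
    ((- + 1) * M zero zero * det (suc n) (λ r c → M′ (punchIn (suc zero) r) (suc c)) +
    sumFinℤ (λ i → - - sgn (toℕ i) * M (suc (suc i)) zero * det (suc n) (λ r c → M′ (punchIn (suc (suc i)) r) (suc c))))
    ≡⟨ cong₂ (λ x y → + 1 * b * x + y)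
         (det-cong (suc n) (λ r c → M′ (suc r) (suc c)) (λ r c → M (punchIn (suc zero) r) (suc c))
           λ { zero c → refl ; (suc r) c → refl })
         (cong₂ (λ x y → (- + 1) * a * x + y)
           (det-cong (suc n) (λ r c → M′ (punchIn (suc zero) r) (suc c)) (λ r c → M (suc r) (suc c))
             λ { zero c → refl ; (suc r) c → refl })
           (trans
             (sum-cong λ i → trans (cong (coeff i *_) (lower n M i)) (pull-neg (coeff i) (minor i)))
             (sym (*-sum (- + 1) (λ i → coeff i * minor i))))) ⟩
  + 1 * b * B + ((- + 1) * a * A + (- + 1) * rest)
    ≡⟨ rearrange a A b B rest ⟩
  - (+ 1 * a * A + ((- + 1) * b * B + rest))
    ≡⟨ cong -_ (sym (det-column (suc n) M)) ⟩
  - det (suc (suc n)) M ∎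
  where
  M′ : Matrix (suc (suc n))
  M′ r c = M (swap01 r) c
  a = M zero zero
  b = M (suc zero) zero
  A = det (suc n) (λ r c → M (punchIn zero r) (suc c))
  B = det (suc n) (λ r c → M (punchIn (suc zero) r) (suc c))
  coeff minor : Fin n → ℤ
  coeff i = - - sgn (toℕ i) * M (suc (suc i)) zero
  minor i = det (suc n) (λ r c → M (punchIn (suc (suc i)) r) (suc c))
  rest = sumFinℤ (λ i → coeff i * minor i)

  lower : ∀ n (M : Matrix (suc (suc n))) i →
    det (suc n) (λ r c → M (swap01 (punchIn (suc (suc i)) r)) (suc c)) ≡
    - det (suc n) (λ r c → M (punchIn (suc (suc i)) r) (suc c))
  lower (suc n) M i = trans
    (det-cong (suc (suc n)) (λ r c → M (swap01 (punchIn (suc (suc i)) r)) (suc c))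
      (λ r c → M (punchIn (suc (suc i)) (swap01 r)) (suc c))
      λ { zero c → refl ; (suc zero) c → refl ; (suc (suc r)) c → refl })
    (det-swap01 n (λ r c → M (punchIn (suc (suc i)) r) (suc c)))

  pull-neg : ∀ a x → a * (- x) ≡ (- + 1) * (a * x)
  pull-neg = solve-∀

  rearrange : ∀ a A b B r → + 1 * b * B + ((- + 1) * a * A + (- + 1) * r) ≡ - (+ 1 * a * A + ((- + 1) * b * B + r))
  rearrange = solve-∀

toFront : ∀ {n} → Fin (suc n) → Fin (suc n) → Fin (suc n)
toFront k zero    = k
toFront k (suc r) = punchIn k r

-- Row `suc k` is first brought to position 1, which by induction costs `sgn k` in every minor of
-- the first row, and is then swapped with row 0.
det-toFront : ∀ n k (M : Matrix (suc n)) → det (suc n) (λ r c → M (toFront k r) c) ≡ sgn (toℕ k) * det (suc n) M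
det-toFront n zero M = trans
  (det-cong (suc n) (λ r c → M (toFront zero r) c) M λ { zero c → refl ; (suc r) c → refl }) (sym (*-identityˡ (det (suc n) M)))
det-toFront (suc n) (suc k) M = begin
  det (suc (suc n)) (λ r c → M (toFront (suc k) r) c)
    ≡⟨ det-cong (suc (suc n)) (λ r c → M (toFront (suc k) r) c) (λ r c → N (swap01 r) c) (λ { zero c → refl ; (suc zero) c → refl ; (suc (suc r)) c → refl }) ⟩
  det (suc (suc n)) (λ r c → N (swap01 r) c)
    ≡⟨ det-swap01 n N ⟩
  - det (suc (suc n)) N
    ≡⟨ cong -_ (trans (sum-cong (λ j → trans
         (cong (sgn (toℕ j) * M zero j *_) (det-toFront n k (λ r c → M (suc r) (punchIn j c))))
         (pull (sgn (toℕ k)) (sgn (toℕ j) * M zero j) (minor j))))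
         (sym (*-sum (sgn (toℕ k)) (λ j → sgn (toℕ j) * M zero j * minor j)))) ⟩
  - (sgn (toℕ k) * det (suc (suc n)) M)
    ≡⟨ push (sgn (toℕ k)) (det (suc (suc n)) M) ⟩
  (- sgn (toℕ k)) * det (suc (suc n)) M ∎
  where
  N : Matrix (suc (suc n))
  N zero    c = M zero c
  N (suc r) c = M (suc (toFront k r)) c

  minor : Fin (suc (suc n)) → ℤ
  minor j = det (suc n) (λ r c → M (suc r) (punchIn j c))

  pull : ∀ s a d → a * (s * d) ≡ s * (a * d)
  pull = solve-∀

  push : ∀ s d → - (s * d) ≡ (- s) * d
  push = solve-∀

-- Defined by recursion on the image of zero; only its square matters for det-conjugate.
sign : ∀ n → Permutation n n → ℤ
sign zero    π = + 1
sign (suc n) π = sgn (toℕ (π ⟨$⟩ʳ zero)) * sign n (remove zero π)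

sign² : ∀ n (π : Permutation n n) → sign n π * sign n π ≡ + 1
sign² zero    π = refl
sign² (suc n) π = trans (square-* (sgn (toℕ (π ⟨$⟩ʳ zero))) (sign n (remove zero π)))
  (cong₂ _*_ (sgn² (toℕ (π ⟨$⟩ʳ zero))) (sign² n (remove zero π)))
  where
  square-* : ∀ a b → a * b * (a * b) ≡ a * a * (b * b)
  square-* = solve-∀

-- Once the image k of zero is in front, `π` acts on the other rows as `remove zero π`. Induction
-- inside the cofactors of the first row undoes that part, and `det-toFront` puts row k back.
det-permuteRows : ∀ n (π : Permutation n n) (M : Matrix n) →
  det n (λ r c → M (π ⟨$⟩ʳ r) c) ≡ sign n π * det n M
det-permuteRows zero    π M = refl
det-permuteRows (suc n) π M = begin
  det (suc n) (λ r c → M (π ⟨$⟩ʳ r) c)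
    ≡⟨ det-cong (suc n) (λ r c → M (π ⟨$⟩ʳ r) c) N (λ { zero c → refl ; (suc r) c → cong (λ i → M i c) (punchIn-permute π zero r) }) ⟩
  det (suc n) N
    ≡⟨ trans (sum-cong λ j → trans (cong (sgn (toℕ j) * M k j *_) (det-permuteRows n ρ (λ r c → M (punchIn k r) (punchIn j c))))
         (pull (sign n ρ) (sgn (toℕ j) * M k j) (minor j)))
         (sym (*-sum (sign n ρ) (λ j → sgn (toℕ j) * M k j * minor j))) ⟩
  sign n ρ * det (suc n) (λ r c → M (toFront k r) c)
    ≡⟨ cong (sign n ρ *_) (det-toFront n k M) ⟩
  sign n ρ * (sgn (toℕ k) * det (suc n) M)
    ≡⟨ pull′ (sign n ρ) (sgn (toℕ k)) (det (suc n) M) ⟩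
  sgn (toℕ k) * sign n ρ * det (suc n) M ∎
  where
  k = π ⟨$⟩ʳ zero
  ρ = remove zero π
  N : Matrix (suc n)
  N zero    c = M k c
  N (suc r) c = M (punchIn k (ρ ⟨$⟩ʳ r)) c

  minor : Fin (suc n) → ℤ
  minor j = det n (λ r c → M (punchIn k r) (punchIn j c))

  pull : ∀ s a d → a * (s * d) ≡ s * (a * d)
  pull = solve-∀

  pull′ : ∀ s a d → s * (a * d) ≡ a * s * d
  pull′ = solve-∀

det-conjugate : ∀ n (π : Permutation n n) (M : Matrix n) →
  det n (λ r c → M (π ⟨$⟩ʳ r) (π ⟨$⟩ʳ c)) ≡ det n M
det-conjugate n π M = begin
  det n (λ r c → M (π ⟨$⟩ʳ r) (π ⟨$⟩ʳ c))
    ≡⟨ det-permuteRows n π (λ r c → M r (π ⟨$⟩ʳ c)) ⟩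
  sign n π * det n (λ r c → M r (π ⟨$⟩ʳ c))
    ≡⟨ cong (sign n π *_) (sym (det-transpose n (λ r c → M r (π ⟨$⟩ʳ c)))) ⟩
  sign n π * det n (λ r c → M c (π ⟨$⟩ʳ r))
    ≡⟨ cong (sign n π *_) (det-permuteRows n π (λ r c → M c r)) ⟩
  sign n π * (sign n π * det n (λ r c → M c r))
    ≡⟨ sym (*-assoc (sign n π) (sign n π) _) ⟩
  sign n π * sign n π * det n (λ r c → M c r)
    ≡⟨ cong₂ _*_ (sign² n π) (det-transpose n M) ⟩
  + 1 * det n M
    ≡⟨ *-identityˡ _ ⟩
  det n M ∎

-- Moving row `v` to the front costs the sign of `v`, and the only surviving cofactor, in column
-- `v`, carries the same sign.
det-unitRow : ∀ n v (M : Matrix (suc n)) e → (∀ c → M v c ≡ e * δ v c) →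
  det (suc n) M ≡ e * det n (λ r c → M (punchIn v r) (punchIn v c))
det-unitRow n v M e row = begin
  det (suc n) M
    ≡⟨ sym (*-identityˡ _) ⟩
  + 1 * det (suc n) M
    ≡⟨ cong (_* det (suc n) M) (sym (sgn² (toℕ v))) ⟩
  s * s * det (suc n) M
    ≡⟨ *-assoc s s _ ⟩
  s * (s * det (suc n) M)
    ≡⟨ cong (s *_) (sym (det-toFront n v M)) ⟩
  s * sumFinℤ (λ j → sgn (toℕ j) * M v j * det n (λ r c → M (punchIn v r) (punchIn j c)))
    ≡⟨ cong (s *_) (sum-single v λ j j≢v → trans
         (cong (λ x → sgn (toℕ j) * x * det n (λ r c → M (punchIn v r) (punchIn j c)))
           (trans (row j) (trans (cong (e *_) (δ-≢ (j≢v ∘ sym))) (*-zeroʳ e))))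
         (vanish (sgn (toℕ j)) (det n (λ r c → M (punchIn v r) (punchIn j c))))) ⟩
  s * (s * M v v * m)
    ≡⟨ cong (λ x → s * (s * x * m)) (trans (row v) (cong (e *_) (δ-refl v))) ⟩
  s * (s * (e * + 1) * m)
    ≡⟨ regroup s e m ⟩
  s * s * (e * m)
    ≡⟨ cong (_* (e * m)) (sgn² (toℕ v)) ⟩
  + 1 * (e * m)
    ≡⟨ *-identityˡ _ ⟩
  e * m ∎
  where
  s = sgn (toℕ v)
  m = det n (λ r c → M (punchIn v r) (punchIn v c))
  vanish : ∀ a d → a * + 0 * d ≡ + 0
  vanish = solve-∀
  regroup : ∀ s e m → s * (s * (e * + 1) * m) ≡ s * s * (e * m)
  regroup = solve-∀

-- Bordered determinants

vanish : ∀ s a d → s * (a * + 0) * d ≡ + 0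
vanish = solve-∀

module Bordered {n : ℕ} (v : Fin (suc n)) (M : Matrix (suc n)) where

  minor : ℤ
  minor = det n (λ r c → M (punchIn v r) (punchIn v c))

  s : ℤ
  s = sgn (toℕ v)

  -- This matrix appears when a cofactor along a border row strikes out column `v` of `M`: the
  -- border column, supported in row `v`, is left standing in front.
  column : ℤ → Matrix (suc n)
  column c i zero    = c * δ i v
  column c i (suc j) = M i (punchIn v j)

  det-column-δ : ∀ c → det (suc n) (column c) ≡ s * c * minor
  det-column-δ c = begin
    det (suc n) (column c)
      ≡⟨ det-column n (column c) ⟩
    sumFinℤ (λ i → sgn (toℕ i) * (c * δ i v) * cofactor i)
      ≡⟨ sum-single v (λ i i≢v → trans (cong (λ x → sgn (toℕ i) * (c * x) * cofactor i) (δ-≢ i≢v)) (vanish (sgn (toℕ i)) c (cofactor i))) ⟩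
    s * (c * δ v v) * minor
      ≡⟨ cong (λ x → s * (c * x) * minor) (δ-refl v) ⟩
    s * (c * + 1) * minor
      ≡⟨ simplify s c minor ⟩
    s * c * minor ∎
    where
    cofactor : Fin (suc n) → ℤ
    cofactor i = det n (λ r c → M (punchIn i r) (punchIn v c))
    simplify : ∀ s c m → s * (c * + 1) * m ≡ s * c * m
    simplify = solve-∀

  border₁ : ℤ → ℤ → ℤ → Matrix (suc (suc n))
  border₁ r b c zero    zero    = r
  border₁ r b c zero    (suc j) = b * δ j v
  border₁ r b c (suc i) zero    = c * δ i v
  border₁ r b c (suc i) (suc j) = M i j

  det-border₁ : ∀ r b c → det (suc (suc n)) (border₁ r b c) ≡ r * det (suc n) M - b * c * minor
  det-border₁ r b c = begin
    + 1 * r * det (suc n) M + sumFinℤ (λ j → (- sgn (toℕ j)) * (b * δ j v) * cofactor j)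
      ≡⟨ cong (_+_ (+ 1 * r * det (suc n) M)) (sum-single v (λ j j≢v → trans
           (cong (λ x → (- sgn (toℕ j)) * (b * x) * cofactor j) (δ-≢ j≢v))
           (vanish (- sgn (toℕ j)) b (cofactor j)))) ⟩
    + 1 * r * det (suc n) M + (- s) * (b * δ v v) * cofactor v
      ≡⟨ cong₂ (λ x y → + 1 * r * det (suc n) M + (- s) * (b * x) * y) (δ-refl v) (trans
           (det-cong (suc n) (λ r′ c′ → border₁ r b c (suc r′) (punchIn (suc v) c′)) (column c)
             λ { i zero → refl ; i (suc j) → refl })
           (det-column-δ c)) ⟩
    + 1 * r * det (suc n) M + (- s) * (b * + 1) * (s * c * minor)
      ≡⟨ regroup r (det (suc n) M) s b c minor ⟩
    r * det (suc n) M - s * s * (b * c * minor)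
      ≡⟨ cong (λ x → r * det (suc n) M - x * (b * c * minor)) (sgn² (toℕ v)) ⟩
    r * det (suc n) M - + 1 * (b * c * minor)
      ≡⟨ cong (_-_ (r * det (suc n) M)) (*-identityˡ (b * c * minor)) ⟩
    r * det (suc n) M - b * c * minor ∎
    where
    cofactor : Fin (suc n) → ℤ
    cofactor j = det (suc n) (λ r′ c′ → border₁ r b c (suc r′) (punchIn (suc j) c′))
    regroup : ∀ r d s b c m → + 1 * r * d + (- s) * (b * + 1) * (s * c * m) ≡ r * d - s * s * (b * c * m)
    regroup = solve-∀

  -- The two border rows have independent entries because the weights of the two new vertices will
  -- scale rows separately. The two border columns share `c`: below the border they only see the row
  -- of `v`.
  border₂ : (p q a q′ r b c : ℤ) → Matrix (suc (suc (suc n)))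
  border₂ p q a q′ r b c zero          zero          = p
  border₂ p q a q′ r b c zero          (suc zero)    = q
  border₂ p q a q′ r b c zero          (suc (suc j)) = a * δ j v
  border₂ p q a q′ r b c (suc zero)    zero          = q′
  border₂ p q a q′ r b c (suc zero)    (suc zero)    = r
  border₂ p q a q′ r b c (suc zero)    (suc (suc j)) = b * δ j v
  border₂ p q a q′ r b c (suc (suc i)) zero          = c * δ i v
  border₂ p q a q′ r b c (suc (suc i)) (suc zero)    = c * δ i v
  border₂ p q a q′ r b c (suc (suc i)) (suc (suc j)) = M i j

  det-border₂ : ∀ p q a q′ r b c → det (suc (suc (suc n))) (border₂ p q a q′ r b c) ≡
    (p * r - q * q′) * det (suc n) M - c * (p * b - q * b - q′ * a + r * a) * minor
  det-border₂ p q a q′ r b c = begin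
    + 1 * p * det (suc (suc n)) (λ i j → X (suc i) (suc j)) +
      ((- + 1) * q * det (suc (suc n)) (λ i j → X (suc i) (punchIn (suc zero) j)) +
      sumFinℤ (λ j → - - sgn (toℕ j) * (a * δ j v) * cofactor j))
      ≡⟨ cong₂ (λ x y → + 1 * p * x + y)
           (trans (det-cong (suc (suc n)) (λ i j → X (suc i) (suc j)) (border₁ r b c)
               λ { zero zero → refl ; zero (suc j) → refl ; (suc i) zero → refl ; (suc i) (suc j) → refl })
             (det-border₁ r b c))
           (cong₂ (λ x y → (- + 1) * q * x + y)
             (trans (det-cong (suc (suc n)) (λ i j → X (suc i) (punchIn (suc zero) j)) (border₁ q′ b c)
                 λ { zero zero → refl ; zero (suc j) → refl ; (suc i) zero → refl ; (suc i) (suc j) → refl })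
               (det-border₁ q′ b c))
             (sum-single v (λ j j≢v → trans
               (cong (λ x → - - sgn (toℕ j) * (a * x) * cofactor j) (δ-≢ j≢v))
               (vanish (- - sgn (toℕ j)) a (cofactor j))))) ⟩
    + 1 * p * (r * D - b * c * minor) + ((- + 1) * q * (q′ * D - b * c * minor) + - - s * (a * δ v v) * cofactor v)
      ≡⟨ cong₂ (λ x y → + 1 * p * (r * D - b * c * minor) + ((- + 1) * q * (q′ * D - b * c * minor) + - - s * (a * x) * y))
           (δ-refl v) cofactor-v ⟩
    + 1 * p * (r * D - b * c * minor) + ((- + 1) * q * (q′ * D - b * c * minor) + - - s * (a * + 1) * ((q′ - r) * (s * c * minor)))
      ≡⟨ regroup p q a q′ r b c D minor s ⟩
    (p * r - q * q′) * D - c * (p * b - q * b) * minor - s * s * (c * (r * a - q′ * a) * minor)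
      ≡⟨ cong (λ x → (p * r - q * q′) * D - c * (p * b - q * b) * minor - x * (c * (r * a - q′ * a) * minor)) (sgn² (toℕ v)) ⟩
    (p * r - q * q′) * D - c * (p * b - q * b) * minor - + 1 * (c * (r * a - q′ * a) * minor)
      ≡⟨ collect p q a q′ r b c D minor ⟩
    (p * r - q * q′) * D - c * (p * b - q * b - q′ * a + r * a) * minor ∎
    where
    X = border₂ p q a q′ r b c
    D = det (suc n) M

    cofactor : Fin (suc n) → ℤ
    cofactor j = det (suc (suc n)) (λ r′ c′ → X (suc r′) (punchIn (suc (suc j)) c′))

    tail : Fin n → ℤ
    tail j = det (suc n) (λ i c′ → X (suc (suc i)) (punchIn (suc (suc v)) (punchIn (suc (suc j)) c′)))

    factor : ∀ q r y → + 1 * q * y + ((- + 1) * r * y + + 0) ≡ (q - r) * y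
    factor = solve-∀

    cofactor-v : cofactor v ≡ (q′ - r) * (s * c * minor)
    cofactor-v = begin
      + 1 * q′ * det (suc n) (λ i j → X (suc (suc i)) (punchIn (suc (suc v)) (suc j))) +
        ((- + 1) * r * det (suc n) (λ i j → X (suc (suc i)) (punchIn (suc (suc v)) (punchIn (suc zero) j))) +
        sumFinℤ (λ j → - - sgn (toℕ j) * (b * δ (punchIn v j) v) * tail j))
        ≡⟨ cong₂ (λ x y → + 1 * q′ * x + y)
             (trans (det-cong (suc n) (λ i j → X (suc (suc i)) (punchIn (suc (suc v)) (suc j))) (column c)
               λ { i zero → refl ; i (suc j) → refl }) (det-column-δ c))
             (cong₂ (λ x y → (- + 1) * r * x + y)
               (trans (det-cong (suc n) (λ i j → X (suc (suc i)) (punchIn (suc (suc v)) (punchIn (suc zero) j))) (column c)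
                 λ { i zero → refl ; i (suc j) → refl }) (det-column-δ c))
               -- The row `b * δ j v` has its only entry beyond the border in column `v`, which has
               -- already been removed.
               (sum-zero λ j → trans
                 (cong (λ x → - - sgn (toℕ j) * (b * x) * tail j) (δ-≢ (punchInᵢ≢i v j)))
                 (vanish (- - sgn (toℕ j)) b (tail j)))) ⟩
      + 1 * q′ * (s * c * minor) + ((- + 1) * r * (s * c * minor) + + 0)
        ≡⟨ factor q′ r (s * c * minor) ⟩
      (q′ - r) * (s * c * minor) ∎

    regroup : ∀ p q a q′ r b c D m s →
      + 1 * p * (r * D - b * c * m) + ((- + 1) * q * (q′ * D - b * c * m) + - - s * (a * + 1) * ((q′ - r) * (s * c * m))) ≡
      (p * r - q * q′) * D - c * (p * b - q * b) * m - s * s * (c * (r * a - q′ * a) * m)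
    regroup = solve-∀

    collect : ∀ p q a q′ r b c D m →
      (p * r - q * q′) * D - c * (p * b - q * b) * m - + 1 * (c * (r * a - q′ * a) * m) ≡
      (p * r - q * q′) * D - c * (p * b - q * b - q′ * a + r * a) * m
    collect = solve-∀

-- The tree of a graph in 𝒯

sumFin-cong : ∀ {n} {f g : Fin n → ℕ} → (∀ i → f i ≡ g i) → sumFin f ≡ sumFin g
sumFin-cong {zero}  f≗g = refl
sumFin-cong {suc n} f≗g = cong₂ _+ⁿ_ (f≗g zero) (sumFin-cong (f≗g ∘ suc))

sumFin-zero : ∀ {n} {f : Fin n → ℕ} → (∀ i → f i ≡ 0) → sumFin f ≡ 0
sumFin-zero {zero}  f≗0 = refl
sumFin-zero {suc n} f≗0 = cong₂ _+ⁿ_ (f≗0 zero) (sumFin-zero (f≗0 ∘ suc))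

sumFin-indicator : ∀ {n} (v : Fin n) → sumFin (λ u → b2n ⌊ u ≟ v ⌋) ≡ 1
sumFin-indicator {suc n} zero    = cong suc (sumFin-zero {n} λ _ → refl)
sumFin-indicator {suc n} (suc v) = trans (sumFin-cong λ u → cong b2n (≟-suc u v)) (sumFin-indicator v)

deg-new₀ : ∀ {n} (A : Adj n) v → deg (glue A v) zero ≡ 2
deg-new₀ A v = cong suc (sumFin-indicator v)

deg-glued : ∀ {n} (A : Adj n) v → deg (glue A v) (suc (suc v)) ≡ 2 +ⁿ deg A v
deg-glued A v rewrite ≟-refl v = refl

deg-old : ∀ {n} (A : Adj n) {u v} → u ≢ v → deg (glue A v) (suc (suc u)) ≡ deg A u
deg-old A u≢v rewrite ≟-≢ u≢v = refl

deg-glued≢2 : ∀ {n} (A : Adj n) v → deg A v ≡ 2 → deg (glue A v) (suc (suc v)) ≢ 2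
deg-glued≢2 A v dv eq with trans (sym eq) (trans (deg-glued A v) (cong (2 +ⁿ_) dv))
... | ()

leaf-old : ∀ {n} (A : Adj n) u v → deg A v ≡ 2 → deg (glue A v) (suc (suc u)) ≡ 2 → u ≢ v × deg A u ≡ 2
leaf-old A u v dv eq = u≢v , trans (sym (deg-old A u≢v)) eq
  where
  u≢v : u ≢ v
  u≢v refl = deg-glued≢2 A v dv eq

-- S has one node for each vertex of the graph plus one centre (the initial triangle).
-- The node of a vertex v is the end of the edge v of S away from the centre: it is a
-- leaf while v has degree 2 and becomes the triangle glued at v.  dist is the distance
-- of such nodes; gluing at v appends two leaves to the node of v.
size : ∀ {n A} → Built n A → ℕ
size base         = 1
size (step b _ _) = suc (size b)

dist : ∀ {n A} → Built n A → Fin n → Fin n → ℕ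
dist base x y = if ⌊ x ≟ y ⌋ then 0 else 2
dist (step b v _) zero          zero          = 0
dist (step b v _) zero          (suc zero)    = 2
dist (step b v _) (suc zero)    zero          = 2
dist (step b v _) (suc zero)    (suc zero)    = 0
dist (step b v _) zero          (suc (suc y)) = suc (dist b y v)
dist (step b v _) (suc zero)    (suc (suc y)) = suc (dist b y v)
dist (step b v _) (suc (suc x)) zero          = suc (dist b x v)
dist (step b v _) (suc (suc x)) (suc zero)    = suc (dist b x v)
dist (step b v _) (suc (suc x)) (suc (suc y)) = dist b x y

dist-sym : ∀ {n A} (b : Built n A) x y → dist b x y ≡ dist b y x
dist-sym base x y = cong (if_then 0 else 2) (≟-sym x y)
dist-sym (step b v _) zero          zero          = refl
dist-sym (step b v _) zero          (suc zero)    = refl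
dist-sym (step b v _) (suc zero)    zero          = refl
dist-sym (step b v _) (suc zero)    (suc zero)    = refl
dist-sym (step b v _) zero          (suc (suc y)) = refl
dist-sym (step b v _) (suc zero)    (suc (suc y)) = refl
dist-sym (step b v _) (suc (suc x)) zero          = refl
dist-sym (step b v _) (suc (suc x)) (suc zero)    = refl
dist-sym (step b v _) (suc (suc x)) (suc (suc y)) = dist-sym b x y

-- Weighted size, transmission and Wiener index

Weight : ℕ → Set
Weight n = Fin n → ℤ

old : ∀ {n} → Weight (suc (suc n)) → Weight n
old w u = w (suc (suc u))

-- Weighted number of nodes, distance sum from a node, and Wiener index of S, where the
-- centre has weight 1.  Weight 0 on a leaf deletes it.
mass : ∀ {n A} → Built n A → Weight n → ℤ
mass base w = + 1 + w zero + w (suc zero) + w (suc (suc zero))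
mass (step b v _) w = mass b (old w) + (w zero + w (suc zero))

transmission : ∀ {n A} → Built n A → Weight n → Fin n → ℤ
transmission base w zero             = + 1 + + 2 * (w (suc zero) + w (suc (suc zero)))
transmission base w (suc zero)       = + 1 + + 2 * (w zero + w (suc (suc zero)))
transmission base w (suc (suc zero)) = + 1 + + 2 * (w zero + w (suc zero))
transmission (step b v _) w zero          = transmission b (old w) v + mass b (old w) + + 2 * w (suc zero)
transmission (step b v _) w (suc zero)    = transmission b (old w) v + mass b (old w) + + 2 * w zero
transmission (step b v _) w (suc (suc x)) =
  transmission b (old w) x + (w zero + w (suc zero)) * + suc (dist b x v)

wiener : ∀ {n A} → Built n A → Weight n → ℤ
wiener base w = w₀ + w₁ + w₂ + + 2 * (w₀ * w₁ + w₀ * w₂ + w₁ * w₂)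
  where
  w₀ = w zero
  w₁ = w (suc zero)
  w₂ = w (suc (suc zero))
wiener (step b v _) w = wiener b (old w) +
  ((w zero + w (suc zero)) * (transmission b (old w) v + mass b (old w)) + + 2 * (w zero * w (suc zero)))

clear : ∀ {n} → Fin n → Weight n → Weight n
clear zero    w zero    = + 0
clear zero    w (suc x) = w (suc x)
clear (suc v) w zero    = w zero
clear (suc v) w (suc x) = clear v (w ∘ suc) x

clear-same : ∀ {n} v (w : Weight n) → clear v w v ≡ + 0
clear-same zero    w = refl
clear-same (suc v) w = clear-same v (w ∘ suc)

clear-punchIn : ∀ {n} v (w : Weight (suc n)) u → clear v w (punchIn v u) ≡ w (punchIn v u)
clear-punchIn zero    w u       = refl
clear-punchIn (suc v) w zero    = refl
clear-punchIn (suc v) w (suc u) = clear-punchIn v (w ∘ suc) u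

clear-other : ∀ {n} {v u} (w : Weight n) → u ≢ v → clear v w u ≡ w u
clear-other {v = zero}  {zero}  w u≢v = ⊥-elim (u≢v refl)
clear-other {v = zero}  {suc u} w u≢v = refl
clear-other {v = suc v} {zero}  w u≢v = refl
clear-other {v = suc v} {suc u} w u≢v = clear-other (w ∘ suc) (u≢v ∘ cong suc)

mass-clear : ∀ {n A} (b : Built n A) w u → mass b w ≡ mass b (clear u w) + w u
mass-clear base w zero = lemma (w zero) (w (suc zero)) (w (suc (suc zero)))
  where
  lemma : ∀ a b c → + 1 + a + b + c ≡ + 1 + + 0 + b + c + a
  lemma = solve-∀
mass-clear base w (suc zero) = lemma (w zero) (w (suc zero)) (w (suc (suc zero)))
  where
  lemma : ∀ a b c → + 1 + a + b + c ≡ + 1 + a + + 0 + c + b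
  lemma = solve-∀
mass-clear base w (suc (suc zero)) = lemma (w zero) (w (suc zero)) (w (suc (suc zero)))
  where
  lemma : ∀ a b c → + 1 + a + b + c ≡ + 1 + a + b + + 0 + c
  lemma = solve-∀
mass-clear (step b v _) w zero = lemma (mass b (old w)) (w zero) (w (suc zero))
  where
  lemma : ∀ m a b → m + (a + b) ≡ m + (+ 0 + b) + a
  lemma = solve-∀
mass-clear (step b v _) w (suc zero) = lemma (mass b (old w)) (w zero) (w (suc zero))
  where
  lemma : ∀ m a b → m + (a + b) ≡ m + (a + + 0) + b
  lemma = solve-∀
mass-clear (step b v _) w (suc (suc u)) = trans
  (cong (_+ (w zero + w (suc zero))) (mass-clear b (old w) u))
  (lemma (mass b (clear u (old w))) (old w u) (w zero + w (suc zero)))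
  where
  lemma : ∀ m a b → m + a + b ≡ m + b + a
  lemma = solve-∀

transmission-clear : ∀ {n A} (b : Built n A) w u x →
  transmission b w x ≡ transmission b (clear u w) x + w u * + dist b u x
transmission-clear base w u x = go u x
  where
  same : ∀ b c a → + 1 + + 2 * (b + c) ≡ + 1 + + 2 * (b + c) + a * + 0
  same = solve-∀
  fst : ∀ b c → + 1 + + 2 * (b + c) ≡ + 1 + + 2 * (+ 0 + c) + b * + 2
  fst = solve-∀
  snd : ∀ b c → + 1 + + 2 * (b + c) ≡ + 1 + + 2 * (b + + 0) + c * + 2
  snd = solve-∀
  w₀ = w zero
  w₁ = w (suc zero)
  w₂ = w (suc (suc zero))
  go : ∀ u x → transmission base w x ≡ transmission base (clear u w) x + w u * + dist base u x
  go zero             zero             = same w₁ w₂ w₀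
  go zero             (suc zero)       = fst w₀ w₂
  go zero             (suc (suc zero)) = fst w₀ w₁
  go (suc zero)       zero             = fst w₁ w₂
  go (suc zero)       (suc zero)       = same w₀ w₂ w₁
  go (suc zero)       (suc (suc zero)) = snd w₀ w₁
  go (suc (suc zero)) zero             = snd w₁ w₂
  go (suc (suc zero)) (suc zero)       = snd w₀ w₂
  go (suc (suc zero)) (suc (suc zero)) = same w₀ w₁ w₂
transmission-clear (step b v _) w zero zero =
  lemma (transmission b (old w) v + mass b (old w)) (w zero) (w (suc zero))
  where
  lemma : ∀ s a b → s + + 2 * b ≡ s + + 2 * b + a * + 0
  lemma = solve-∀
transmission-clear (step b v _) w zero (suc zero) =
  lemma (transmission b (old w) v + mass b (old w)) (w zero)
  where
  lemma : ∀ s a → s + + 2 * a ≡ s + + 2 * + 0 + a * + 2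
  lemma = solve-∀
transmission-clear (step b v _) w (suc zero) zero =
  lemma (transmission b (old w) v + mass b (old w)) (w (suc zero))
  where
  lemma : ∀ s a → s + + 2 * a ≡ s + + 2 * + 0 + a * + 2
  lemma = solve-∀
transmission-clear (step b v _) w (suc zero) (suc zero) =
  lemma (transmission b (old w) v + mass b (old w)) (w zero) (w (suc zero))
  where
  lemma : ∀ s a b → s + + 2 * a ≡ s + + 2 * a + b * + 0
  lemma = solve-∀
transmission-clear (step b v _) w zero (suc (suc x)) =
  lemma (transmission b (old w) x) (w zero) (w (suc zero)) (+ suc (dist b x v))
  where
  lemma : ∀ s a b d → s + (a + b) * d ≡ s + (+ 0 + b) * d + a * d
  lemma = solve-∀
transmission-clear (step b v _) w (suc zero) (suc (suc x)) =
  lemma (transmission b (old w) x) (w zero) (w (suc zero)) (+ suc (dist b x v))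
  where
  lemma : ∀ s a b d → s + (a + b) * d ≡ s + (a + + 0) * d + b * d
  lemma = solve-∀
transmission-clear (step b v _) w (suc (suc u)) zero = trans
  (cong₂ (λ s m → s + m + + 2 * w (suc zero)) (transmission-clear b (old w) u v) (mass-clear b (old w) u))
  (lemma (transmission b (clear u (old w)) v) (mass b (clear u (old w))) (old w u) (w (suc zero)) (+ dist b u v))
  where
  lemma : ∀ s m a b d → s + a * d + (m + a) + + 2 * b ≡ s + m + + 2 * b + a * (+ 1 + d)
  lemma = solve-∀
transmission-clear (step b v _) w (suc (suc u)) (suc zero) = trans
  (cong₂ (λ s m → s + m + + 2 * w zero) (transmission-clear b (old w) u v) (mass-clear b (old w) u))
  (lemma (transmission b (clear u (old w)) v) (mass b (clear u (old w))) (old w u) (w zero) (+ dist b u v))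
  where
  lemma : ∀ s m a b d → s + a * d + (m + a) + + 2 * b ≡ s + m + + 2 * b + a * (+ 1 + d)
  lemma = solve-∀
transmission-clear (step b v _) w (suc (suc u)) (suc (suc x)) = trans
  (cong (_+ (w zero + w (suc zero)) * + suc (dist b x v)) (transmission-clear b (old w) u x))
  (lemma (transmission b (clear u (old w)) x) (old w u * + dist b u x) ((w zero + w (suc zero)) * + suc (dist b x v)))
  where
  lemma : ∀ s a b → s + a + b ≡ s + b + a
  lemma = solve-∀

-- The weighted Wiener index is affine in the weight of `u`, with the distance sum from `u` as
-- slope. That sum does not involve the weight of `u`, the distance from `u` to itself being 0, so
-- it may be taken at `w` instead of at `clear u w`.
wiener-clear : ∀ {n A} (b : Built n A) w u →
  wiener b w ≡ wiener b (clear u w) + w u * transmission b w u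
wiener-clear base w zero = lemma (w zero) (w (suc zero)) (w (suc (suc zero)))
  where
  lemma : ∀ a b c → a + b + c + + 2 * (a * b + a * c + b * c) ≡
    + 0 + b + c + + 2 * (+ 0 * b + + 0 * c + b * c) + a * (+ 1 + + 2 * (b + c))
  lemma = solve-∀
wiener-clear base w (suc zero) = lemma (w zero) (w (suc zero)) (w (suc (suc zero)))
  where
  lemma : ∀ a b c → a + b + c + + 2 * (a * b + a * c + b * c) ≡
    a + + 0 + c + + 2 * (a * + 0 + a * c + + 0 * c) + b * (+ 1 + + 2 * (a + c))
  lemma = solve-∀
wiener-clear base w (suc (suc zero)) = lemma (w zero) (w (suc zero)) (w (suc (suc zero)))
  where
  lemma : ∀ a b c → a + b + c + + 2 * (a * b + a * c + b * c) ≡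
    a + b + + 0 + + 2 * (a * b + a * + 0 + b * + 0) + c * (+ 1 + + 2 * (a + b))
  lemma = solve-∀
wiener-clear (step b v _) w zero =
  lemma (wiener b (old w)) (transmission b (old w) v + mass b (old w)) (w zero) (w (suc zero))
  where
  lemma : ∀ W s a b → W + ((a + b) * s + + 2 * (a * b)) ≡
    W + ((+ 0 + b) * s + + 2 * (+ 0 * b)) + a * (s + + 2 * b)
  lemma = solve-∀
wiener-clear (step b v _) w (suc zero) =
  lemma (wiener b (old w)) (transmission b (old w) v + mass b (old w)) (w zero) (w (suc zero))
  where
  lemma : ∀ W s a b → W + ((a + b) * s + + 2 * (a * b)) ≡
    W + ((a + + 0) * s + + 2 * (a * + 0)) + b * (s + + 2 * a)
  lemma = solve-∀
wiener-clear (step b v _) w (suc (suc u)) = trans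
  (cong₂ (λ W s → W + ((w zero + w (suc zero)) * s + + 2 * (w zero * w (suc zero))))
    (wiener-clear b (old w) u) (cong₂ _+_ (transmission-clear b (old w) u v) (mass-clear b (old w) u)))
  (lemma (wiener b (clear u (old w))) (transmission b (clear u (old w)) v) (mass b (clear u (old w)))
    (transmission b (old w) u) (old w u) (+ dist b u v) (w zero + w (suc zero)) (+ 2 * (w zero * w (suc zero))))
  where
  lemma : ∀ W s m σ a d t p → W + a * σ + (t * (s + a * d + (m + a)) + p) ≡
    W + (t * (s + m) + p) + a * (σ + t * (+ 1 + d))
  lemma = solve-∀

-- A row of weight 0 is replaced by a negative unit row, which deletes the vertex up to sign.
masked : ∀ {n} → Adj n → Weight n → ℤ → Matrix n
masked A w t i j = w i * ((if ⌊ i ≟ j ⌋ then t else + 0) - b2z (A i j)) - (+ 1 - w i) * δ i j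

-- The lowest coefficient at -2 changes sign with the parity of the number of nodes. The factor -1
-- that each deletion contributes compensates for this, so that one sign serves in `det-expansion`
-- for all weights.
det-masked-clear : ∀ {n} (A : Adj (suc n)) w t v →
  det (suc n) (masked A (clear v w) t) ≡ - Bordered.minor v (masked A w t)
det-masked-clear {n} A w t v = begin
  det (suc n) (masked A (clear v w) t)
    ≡⟨ det-unitRow n v (masked A (clear v w) t) (- + 1) (λ c → trans
         (cong (λ a → a * entry v c - (+ 1 - a) * δ v c) (clear-same v w)) (unit (entry v c) (δ v c))) ⟩
  (- + 1) * det n (λ r c → masked A (clear v w) t (punchIn v r) (punchIn v c))
    ≡⟨ cong ((- + 1) *_) (det-cong n _ _ λ r c →
         cong (λ a → a * entry (punchIn v r) (punchIn v c) - (+ 1 - a) * δ (punchIn v r) (punchIn v c)) (clear-punchIn v w r)) ⟩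
  (- + 1) * Bordered.minor v (masked A w t)
    ≡⟨ neg (Bordered.minor v (masked A w t)) ⟩
  - Bordered.minor v (masked A w t) ∎
  where
  entry : Matrix (suc n)
  entry i j = (if ⌊ i ≟ j ⌋ then t else + 0) - b2z (A i j)
  unit : ∀ e d → + 0 * e - (+ 1 - + 0) * d ≡ (- + 1) * d
  unit = solve-∀
  neg : ∀ m → (- + 1) * m ≡ - m
  neg = solve-∀

diagonal : ∀ a t → a * (t - + 0) - (+ 1 - a) * + 1 ≡ a * t - (+ 1 - a)
diagonal = solve-∀

edge : ∀ a → a * (+ 0 - + 1) - (+ 1 - a) * + 0 ≡ - a
edge = solve-∀

-- This is `det-border₂` with the minor read as the old graph with `v` deleted. Weight 1 at `v`
-- makes its entries in both border columns equal to -1.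
det-masked-glue : ∀ {n} (A : Adj (suc n)) v w t → w (suc (suc v)) ≡ + 1 →
  let w₀ = w zero ; w₁ = w (suc zero) ; p = w₀ * t - (+ 1 - w₀) ; r = w₁ * t - (+ 1 - w₁) in
  det (suc (suc (suc n))) (masked (glue A v) w t) ≡
  (p * r - w₀ * w₁) * det (suc n) (masked A (old w) t)
    + (p * w₁ + w₀ * w₁ + w₀ * w₁ + r * w₀) * det (suc n) (masked A (clear v (old w)) t)
det-masked-glue {n} A v w t wv = begin
  det (suc (suc (suc n))) (masked (glue A v) w t)
    ≡⟨ det-cong (suc (suc (suc n))) _ (B.border₂ p (- w₀) (- w₀) (- w₁) r (- w₁) (- + 1)) entries ⟩
  det (suc (suc (suc n))) (B.border₂ p (- w₀) (- w₀) (- w₁) r (- w₁) (- + 1))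
    ≡⟨ B.det-border₂ p (- w₀) (- w₀) (- w₁) r (- w₁) (- + 1) ⟩
  (p * r - (- w₀) * (- w₁)) * D - (- + 1) * (p * (- w₁) - (- w₀) * (- w₁) - (- w₁) * (- w₀) + r * (- w₀)) * B.minor
    ≡⟨ regroup p r w₀ w₁ D B.minor ⟩
  (p * r - w₀ * w₁) * D + (p * w₁ + w₀ * w₁ + w₀ * w₁ + r * w₀) * (- B.minor)
    ≡⟨ cong (λ x → (p * r - w₀ * w₁) * D + (p * w₁ + w₀ * w₁ + w₀ * w₁ + r * w₀) * x) (sym (det-masked-clear A (old w) t v)) ⟩
  (p * r - w₀ * w₁) * D + (p * w₁ + w₀ * w₁ + w₀ * w₁ + r * w₀) * det (suc n) (masked A (clear v (old w)) t) ∎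
  where
  module B = Bordered v (masked A (old w) t)
  w₀ = w zero
  w₁ = w (suc zero)
  p = w₀ * t - (+ 1 - w₀)
  r = w₁ * t - (+ 1 - w₁)
  D = det (suc n) (masked A (old w) t)

  toOld : ∀ a d → a * (+ 0 - d) - (+ 1 - a) * + 0 ≡ (- a) * d
  toOld = solve-∀
  zero-column : ∀ a → a * (+ 0 - + 0) - (+ 1 - a) * + 0 ≡ (- + 1) * + 0
  zero-column = solve-∀

  fromOld : ∀ i → w (suc (suc i)) * (+ 0 - δ i v) - (+ 1 - w (suc (suc i))) * + 0 ≡ (- + 1) * δ i v
  fromOld i with i ≟ v
  ... | yes refl = cong (λ a → a * (+ 0 - + 1) - (+ 1 - a) * + 0) wv
  ... | no _     = zero-column (w (suc (suc i)))

  entries : ∀ i j → masked (glue A v) w t i j ≡ B.border₂ p (- w₀) (- w₀) (- w₁) r (- w₁) (- + 1) i j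
  entries zero          zero          = diagonal w₀ t
  entries zero          (suc zero)    = edge w₀
  entries zero          (suc (suc j)) = toOld w₀ (δ j v)
  entries (suc zero)    zero          = edge w₁
  entries (suc zero)    (suc zero)    = diagonal w₁ t
  entries (suc zero)    (suc (suc j)) = toOld w₁ (δ j v)
  entries (suc (suc i)) zero          = fromOld i
  entries (suc (suc i)) (suc zero)    = fromOld i
  entries (suc (suc i)) (suc (suc j)) =
    cong (λ e → old w i * ((if e then t else + 0) - b2z (A i j)) - (+ 1 - old w i) * b2z e)
      (trans (≟-suc (suc i) (suc j)) (≟-suc i j))

  regroup : ∀ p r a b D m →
    (p * r - (- a) * (- b)) * D - (- + 1) * (p * (- b) - (- a) * (- b) - (- b) * (- a) + r * (- a)) * m ≡
    (p * r - a * b) * D + (p * b + a * b + a * b + r * a) * (- m)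
  regroup = solve-∀

-- The characteristic polynomial near -2

-- The entries come with equations, so that the solver meets nine atoms and each entry can be
-- supplied in a simplified form.
det₃ : (M : Matrix 3) → ∀ a b c d e f g h i →
  M zero zero ≡ a → M zero (suc zero) ≡ b → M zero (suc (suc zero)) ≡ c →
  M (suc zero) zero ≡ d → M (suc zero) (suc zero) ≡ e → M (suc zero) (suc (suc zero)) ≡ f →
  M (suc (suc zero)) zero ≡ g → M (suc (suc zero)) (suc zero) ≡ h → M (suc (suc zero)) (suc (suc zero)) ≡ i →
  det 3 M ≡ a * (e * i - f * h) - b * (d * i - f * g) + c * (d * h - e * g)
det₃ M _ _ _ _ _ _ _ _ _ refl refl refl refl refl refl refl refl refl =
  lemma (M zero zero) (M zero (suc zero)) (M zero (suc (suc zero)))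
    (M (suc zero) zero) (M (suc zero) (suc zero)) (M (suc zero) (suc (suc zero)))
    (M (suc (suc zero)) zero) (M (suc (suc zero)) (suc zero)) (M (suc (suc zero)) (suc (suc zero)))
  where
  lemma : ∀ a b c d e f g h i →
    + 1 * a * (+ 1 * e * (+ 1 * i * + 1 + + 0) + ((- + 1) * f * (+ 1 * h * + 1 + + 0) + + 0)) +
    ((- + 1) * b * (+ 1 * d * (+ 1 * i * + 1 + + 0) + ((- + 1) * f * (+ 1 * g * + 1 + + 0) + + 0)) +
    (+ 1 * c * (+ 1 * d * (+ 1 * h * + 1 + + 0) + ((- + 1) * e * (+ 1 * g * + 1 + + 0) + + 0)) + + 0))
    ≡ a * (e * i - f * h) - b * (d * i - f * g) + c * (d * h - e * g)
  lemma = solve-∀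

-- The weight is free exactly on the leaf edges of S. A vertex has degree 2 before a triangle is
-- glued to it, hence may be cleared in the old graph; afterwards it has degree 4 and keeps the
-- weight 1 that `det-masked-glue` asks for.
Admissible : ∀ {n} → Adj n → Weight n → Set
Admissible A w = ∀ u → deg A u ≢ 2 → w u ≡ + 1

admissible-old : ∀ {n} (A : Adj n) v w → deg A v ≡ 2 → Admissible (glue A v) w → Admissible A (old w)
admissible-old A v w dv adm u du = adm (suc (suc u)) λ eq → du (proj₂ (leaf-old A u v dv eq))

admissible-clear : ∀ {n} (A : Adj n) v w → deg A v ≡ 2 → Admissible A w → Admissible A (clear v w)
admissible-clear A v w dv adm u du = trans (clear-other {v = v} {u} w λ { refl → du dv }) (adm u du)

-- Up to order ε, the coefficient of `D` is 1 + a + b - ε (a + b + 2ab) and that of `D₀` is -(a + b)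
-- + 2ab ε. Since `m` exceeds `m₀` by 1 and `W` exceeds `W₀` by `σ`, the constant and linear terms
-- combine to exactly the recursions of `mass` and `wiener`.
glue-algebra : ∀ ε a b {D′ D D₀ m W m₀ W₀ σ x y m′ W′ : ℤ} →
  D′ ≡ ((a * (ε - + 2) - (+ 1 - a)) * (b * (ε - + 2) - (+ 1 - b)) - a * b) * D
     + ((a * (ε - + 2) - (+ 1 - a)) * b + a * b + a * b + (b * (ε - + 2) - (+ 1 - b)) * a) * D₀ →
  D ≡ - (m - ε * W + ε * ε * x) → D₀ ≡ - (m₀ - ε * W₀ + ε * ε * y) →
  m ≡ m₀ + + 1 → W ≡ W₀ + + 1 * σ →
  m′ ≡ m + (a + b) → W′ ≡ W + ((a + b) * (σ + m) + + 2 * (a * b)) →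
  ∃[ q ] D′ ≡ - (m′ - ε * W′ + ε * ε * q)
glue-algebra ε a b {m₀ = m} {W} {σ} {x} {y} refl refl refl refl refl refl refl =
  -- Everything of order at least ε²: the two old remainders with their coefficients, then the
  -- products of the ε-parts of the coefficients with the ε-parts of the expansions, and the ε²-part
  -- ab of the first coefficient. In the witness `m`, `W` stand for `m₀`, `W₀`.
  ((a * (ε - + 2) - (+ 1 - a)) * (b * (ε - + 2) - (+ 1 - b)) - a * b) * x
    + ((a * (ε - + 2) - (+ 1 - a)) * b + a * b + a * b + (b * (ε - + 2) - (+ 1 - b)) * a) * y
    + (a + b + + 2 * (a * b)) * (W + σ) + a * b * (m + + 1 - ε * (W + σ)) - + 2 * (a * b) * W
  , lemma ε a b m W σ x y
  where
  lemma : ∀ ε a b m W σ x y →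
    ((a * (ε - + 2) - (+ 1 - a)) * (b * (ε - + 2) - (+ 1 - b)) - a * b) * (- (m + + 1 - ε * (W + + 1 * σ) + ε * ε * x))
    + ((a * (ε - + 2) - (+ 1 - a)) * b + a * b + a * b + (b * (ε - + 2) - (+ 1 - b)) * a) * (- (m - ε * W + ε * ε * y))
    ≡ - (m + + 1 + (a + b) - ε * (W + + 1 * σ + ((a + b) * (σ + (m + + 1)) + + 2 * (a * b))) + ε * ε *
      (((a * (ε - + 2) - (+ 1 - a)) * (b * (ε - + 2) - (+ 1 - b)) - a * b) * x
      + ((a * (ε - + 2) - (+ 1 - a)) * b + a * b + a * b + (b * (ε - + 2) - (+ 1 - b)) * a) * y
      + (a + b + + 2 * (a * b)) * (W + σ) + a * b * (m + + 1 - ε * (W + σ)) - + 2 * (a * b) * W))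
  lemma = solve-∀

triangle-algebra : ∀ ε a b c {D pa pb pc m W : ℤ} →
  D ≡ pa * (pb * pc - (- b) * (- c)) - (- a) * ((- b) * pc - (- b) * (- c)) + (- a) * ((- b) * (- c) - pb * (- c)) →
  pa ≡ a * (ε - + 2) - (+ 1 - a) → pb ≡ b * (ε - + 2) - (+ 1 - b) → pc ≡ c * (ε - + 2) - (+ 1 - c) →
  m ≡ + 1 + a + b + c → W ≡ a + b + c + + 2 * (a * b + a * c + b * c) →
  ∃[ q ] D ≡ - (m - ε * W + ε * ε * q)
triangle-algebra ε a b c refl refl refl refl refl refl =
  a * b + a * c + b * c + (+ 3 - ε) * (a * b * c) , lemma ε a b c
  where
  lemma : ∀ ε a b c →
    (a * (ε - + 2) - (+ 1 - a)) * ((b * (ε - + 2) - (+ 1 - b)) * (c * (ε - + 2) - (+ 1 - c)) - (- b) * (- c))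
    - (- a) * ((- b) * (c * (ε - + 2) - (+ 1 - c)) - (- b) * (- c))
    + (- a) * ((- b) * (- c) - (b * (ε - + 2) - (+ 1 - b)) * (- c))
    ≡ - (+ 1 + a + b + c - ε * (a + b + c + + 2 * (a * b + a * c + b * c))
         + ε * ε * (a * b + a * c + b * c + (+ 3 - ε) * (a * b * c)))
  lemma = solve-∀

-- The determinant of the glued graph also involves the graph with v deleted; allowing any
-- set of degree-2 vertices to be deleted makes the induction close.
det-expansion : ∀ {n A} (b : Built n A) w → Admissible A w → ∀ ε →
  ∃[ q ] det n (masked A w (ε - + 2)) ≡ - (mass b w - ε * wiener b w + ε * ε * q)
det-expansion base w adm ε = triangle-algebra ε w₀ w₁ w₂ {pa = p w₀} {p w₁} {p w₂}
  (det₃ (masked triangle w t) (p w₀) (- w₀) (- w₀) (- w₁) (p w₁) (- w₁) (- w₂) (- w₂) (p w₂)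
    (diagonal w₀ t) (edge w₀) (edge w₀) (edge w₁) (diagonal w₁ t) (edge w₁) (edge w₂) (edge w₂) (diagonal w₂ t))
  refl refl refl refl refl
  where
  t = ε - + 2
  w₀ = w zero
  w₁ = w (suc zero)
  w₂ = w (suc (suc zero))
  p : ℤ → ℤ
  p a = a * t - (+ 1 - a)
det-expansion (step {n = suc n} {A = B} b v dv) w adm ε = glue-algebra ε (w zero) (w (suc zero))
  {D = det (suc n) (masked B (old w) (ε - + 2))} {D₀ = det (suc n) (masked B (clear v (old w)) (ε - + 2))}
  {m = mass b (old w)} {W = wiener b (old w)} {m₀ = m₀} {W₀ = W₀} {σ = σ} {x = proj₁ ih} {y = proj₁ ih₀}
  (det-masked-glue B v w (ε - + 2) wv) (proj₂ ih) (proj₂ ih₀)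
  (trans (mass-clear b (old w) v) (cong (_+_ m₀) wv))
  (trans (wiener-clear b (old w) v) (cong (λ a → W₀ + a * σ) wv))
  refl refl
  where
  m₀ = mass b (clear v (old w))
  W₀ = wiener b (clear v (old w))
  σ = transmission b (old w) v
  adm′ = admissible-old B v w dv adm
  ih = det-expansion b (old w) adm′ ε
  ih₀ = det-expansion b (clear v (old w)) (admissible-clear B v (old w) dv adm′) ε

  -- After the gluing `v` has degree 4, so admissibility fixes its weight.
  wv : w (suc (suc v)) ≡ + 1
  wv = adm (suc (suc v)) (deg-glued≢2 B v dv)

one : ∀ {n} → Weight n
one _ = + 1

charPoly-masked : ∀ {n} (A : Adj n) t → charPoly A t ≡ det n (masked A one t)
charPoly-masked {n} A t = det-cong n _ _ λ i j → lemma ((if ⌊ i ≟ j ⌋ then t else + 0) - b2z (A i j)) (δ i j)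
  where
  lemma : ∀ e d → e ≡ + 1 * e - (+ 1 - + 1) * d
  lemma = solve-∀

charPoly-expansion : ∀ {n A} (b : Built n A) ε →
  ∃[ q ] charPoly A (ε - + 2) ≡ - (mass b one - ε * wiener b one + ε * ε * q)
charPoly-expansion {A = A} b ε with det-expansion b one (λ _ _ → refl) ε
... | q , eq = q , trans (charPoly-masked A (ε - + 2)) eq

-- A nonzero d cannot be divisible by 1 + |d|.
divisible-by-all⇒0 : ∀ d → (∀ ε → ∃[ q ] ε * d ≡ ε * ε * q) → d ≡ + 0
divisible-by-all⇒0 d div with div (+ suc ∣ d ∣)
... | q , eq = ∣i∣≡0⇒i≡0 (small ∣ q ∣ (trans (cong ∣_∣ d≡) (abs-* ε q)))
  where
  ε = + suc ∣ d ∣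
  d≡ : d ≡ ε * q
  d≡ = *-cancelˡ-≡ ε d (ε * q) (trans eq (*-assoc ε ε q))
  small : ∀ k → ∣ d ∣ ≡ suc ∣ d ∣ *ⁿ k → ∣ d ∣ ≡ 0
  small zero    e = trans e (ℕ.*-zeroʳ (suc ∣ d ∣))
  small (suc k) e = ⊥-elim (ℕ.<-irrefl e (ℕ.m≤m*n (suc ∣ d ∣) (suc k)))

-- The remainders depend on ε in an unspecified way. Taking ε = 0 isolates the constant terms; once
-- these agree, ε (W - W′) is a multiple of ε² for every ε.
expansion-unique : ∀ m W m′ W′ →
  (∀ ε → ∃[ q ] ∃[ q′ ] (- (m - ε * W + ε * ε * q) ≡ - (m′ - ε * W′ + ε * ε * q′))) → m ≡ m′ × W ≡ W′
expansion-unique m W m′ W′ eqs = m≡m′ , i-j≡0⇒i≡j W W′ (divisible-by-all⇒0 (W - W′) div)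
  where
  at0 : ∀ m W q → m - + 0 * W + + 0 * + 0 * q ≡ m
  at0 = solve-∀
  m≡m′ : m ≡ m′
  m≡m′ with eqs (+ 0)
  ... | q , q′ , eq = trans (sym (at0 m W q)) (trans (neg-injective eq) (at0 m′ W′ q′))
  solveW : ∀ m ε W W′ q q′ → ε * (W - W′) ≡ ε * ε * (q - q′) + ((m - ε * W′ + ε * ε * q′) - (m - ε * W + ε * ε * q))
  solveW = solve-∀
  cancel : ∀ a x → a + (x - x) ≡ a
  cancel = solve-∀
  div : ∀ ε → ∃[ q ] ε * (W - W′) ≡ ε * ε * q
  div ε with eqs ε
  ... | q , q′ , eq = q - q′ , trans (solveW m ε W W′ q q′) (trans
    (cong (λ x → ε * ε * (q - q′) + (x - (m - ε * W + ε * ε * q)))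
      (trans (cong (λ z → z - ε * W′ + ε * ε * q′) m≡m′) (sym (neg-injective eq))))
    (cancel (ε * ε * (q - q′)) (m - ε * W + ε * ε * q)))

cospectral⇒invariants : ∀ {m n A B} (b : Built m A) (c : Built n B) → Cospectral A B →
  mass b one ≡ mass c one × wiener b one ≡ wiener c one
cospectral⇒invariants b c cosp = expansion-unique (mass b one) (wiener b one) (mass c one) (wiener c one) λ ε →
  let q , eq = charPoly-expansion b ε ; q′ , eq′ = charPoly-expansion c ε in
  q , q′ , trans (sym eq) (trans (cosp (ε - + 2)) eq′)

≟-permute : ∀ {m n} (f : Permutation m n) i j → ⌊ i ≟ j ⌋ ≡ ⌊ f ⟨$⟩ʳ i ≟ f ⟨$⟩ʳ j ⌋
≟-permute f i j with i ≟ j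
... | yes refl = sym (≟-refl (f ⟨$⟩ʳ i))
... | no i≢j   = sym (≟-≢ λ eq → i≢j (trans (sym (inverseˡ f)) (trans (cong (f ⟨$⟩ˡ_) eq) (inverseˡ f))))

charPoly-≅ : ∀ {m n} {A : Adj m} {B : Adj n} → A ≅ B → ∀ t → charPoly A t ≡ charPoly B t
charPoly-≅ {A = A} {B} (f , iso) t with ↔⇒≡ f
... | refl = trans
  (det-cong _ _ (λ i j → (if ⌊ f ⟨$⟩ʳ i ≟ f ⟨$⟩ʳ j ⌋ then t else + 0) - b2z (B (f ⟨$⟩ʳ i) (f ⟨$⟩ʳ j)))
    λ i j → cong₂ (λ e a → (if e then t else + 0) - b2z a) (≟-permute f i j) (sym (iso i j)))
  (det-conjugate _ f (λ i j → (if ⌊ i ≟ j ⌋ then t else + 0) - b2z (B i j)))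

-- Extremal trees

-- The values at weight 1, moved to ℕ for the estimates below. The number of nodes is
-- `2 *ⁿ suc (size b)`. In the initial star a leaf has distance sum 1 + 2 + 2 = 5, and the Wiener
-- index is 3 · 1 + 3 · 2 = 9.
transmissionℕ : ∀ {n A} → Built n A → Fin n → ℕ
transmissionℕ base _ = 5
transmissionℕ (step b v _) zero          = transmissionℕ b v +ⁿ (2 *ⁿ suc (size b) +ⁿ 2)
transmissionℕ (step b v _) (suc zero)    = transmissionℕ b v +ⁿ (2 *ⁿ suc (size b) +ⁿ 2)
transmissionℕ (step b v _) (suc (suc x)) = transmissionℕ b x +ⁿ 2 *ⁿ suc (dist b x v)

wienerℕ : ∀ {n A} → Built n A → ℕ
wienerℕ base         = 9
wienerℕ (step b v _) = wienerℕ b +ⁿ (2 *ⁿ (transmissionℕ b v +ⁿ 2 *ⁿ suc (size b)) +ⁿ 2)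

mass-one : ∀ {n A} (b : Built n A) → mass b one ≡ + (2 *ⁿ suc (size b))
mass-one base         = refl
mass-one (step b v _) = trans (cong (_+ + 2) (mass-one b))
  (cong +_ (trans (ℕ.+-comm (2 *ⁿ suc (size b)) 2) (sym (ℕ.*-suc 2 (suc (size b))))))

transmission-one : ∀ {n A} (b : Built n A) x → transmission b one x ≡ + transmissionℕ b x
transmission-one base zero             = refl
transmission-one base (suc zero)       = refl
transmission-one base (suc (suc zero)) = refl
transmission-one (step b v _) zero       = trans
  (cong₂ (λ s m → s + m + + 2) (transmission-one b v) (mass-one b)) (cong +_ (ℕ.+-assoc (transmissionℕ b v) _ 2))
transmission-one (step b v _) (suc zero) = trans
  (cong₂ (λ s m → s + m + + 2) (transmission-one b v) (mass-one b)) (cong +_ (ℕ.+-assoc (transmissionℕ b v) _ 2))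
transmission-one (step b v _) (suc (suc x)) =
  cong₂ _+_ (transmission-one b x) (sym (pos-* 2 (suc (dist b x v))))

wiener-one : ∀ {n A} (b : Built n A) → wiener b one ≡ + wienerℕ b
wiener-one base         = refl
wiener-one (step b v _) = cong₂ (λ W s → W + (s + + 2)) (wiener-one b)
  (trans (cong (+ 2 *_) (cong₂ _+_ (transmission-one b v) (mass-one b)))
    (sym (pos-* 2 (transmissionℕ b v +ⁿ 2 *ⁿ suc (size b)))))

cospectral⇒size,wiener : ∀ {m n A B} (b : Built m A) (c : Built n B) → Cospectral A B →
  size b ≡ size c × wienerℕ b ≡ wienerℕ c
cospectral⇒size,wiener b c cosp =
  ℕ.suc-injective (ℕ.*-cancelˡ-≡ (suc (size b)) (suc (size c)) 2
    (+-injective (trans (sym (mass-one b)) (trans (proj₁ invariants) (mass-one c))))) ,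
  +-injective (trans (sym (wiener-one b)) (trans (proj₂ invariants) (wiener-one c)))
  where
  invariants : mass b one ≡ mass c one × wiener b one ≡ wiener c one
  invariants = cospectral⇒invariants b c cosp

-- Attained by the caterpillar with k internal nodes (for k = 0, a single edge).
maxTransmission : ℕ → ℕ
maxTransmission zero    = 1
maxTransmission (suc k) = maxTransmission k +ⁿ (2 *ⁿ suc k +ⁿ 2)

maxWiener : ℕ → ℕ
maxWiener zero    = 1
maxWiener (suc k) = maxWiener k +ⁿ (2 *ⁿ (maxTransmission k +ⁿ 2 *ⁿ suc k) +ⁿ 2)

dist≤ : ∀ {n A} (b : Built n A) x y → dist b x y ≤ suc (size b)
dist≤ base x y with ⌊ x ≟ y ⌋
... | true  = z≤n
... | false = ℕ.≤-refl
dist≤ (step b v _) zero          zero          = z≤n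
dist≤ (step b v _) zero          (suc zero)    = s≤s (s≤s z≤n)
dist≤ (step b v _) (suc zero)    zero          = s≤s (s≤s z≤n)
dist≤ (step b v _) (suc zero)    (suc zero)    = z≤n
dist≤ (step b v _) zero          (suc (suc y)) = s≤s (dist≤ b y v)
dist≤ (step b v _) (suc zero)    (suc (suc y)) = s≤s (dist≤ b y v)
dist≤ (step b v _) (suc (suc x)) zero          = s≤s (dist≤ b x v)
dist≤ (step b v _) (suc (suc x)) (suc zero)    = s≤s (dist≤ b x v)
dist≤ (step b v _) (suc (suc x)) (suc (suc y)) = ℕ.m≤n⇒m≤1+n (dist≤ b x y)

2*-suc : ∀ k → 2 *ⁿ suc (suc k) ≡ 2 *ⁿ suc k +ⁿ 2
2*-suc k = trans (ℕ.*-suc 2 (suc k)) (ℕ.+-comm 2 (2 *ⁿ suc k))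

2*suc-dist≤ : ∀ {n A} (b : Built n A) x y → 2 *ⁿ suc (dist b x y) ≤ 2 *ⁿ suc (size b) +ⁿ 2
2*suc-dist≤ b x y = subst (2 *ⁿ suc (dist b x y) ≤_) (2*-suc (size b)) (ℕ.*-monoʳ-≤ 2 (s≤s (dist≤ b x y)))

-- With k triangles before the step, a new leaf exceeds the value at `v` by the 2k + 2 old nodes
-- plus 2. An old node gains twice its distance to a new leaf, which is at most 2 (k + 2), the same
-- amount.
transmission≤ : ∀ {n A} (b : Built n A) x → transmissionℕ b x ≤ maxTransmission (size b)
transmission≤ base x = ℕ.≤-refl
transmission≤ (step b v _) zero          = ℕ.+-monoˡ-≤ _ (transmission≤ b v)
transmission≤ (step b v _) (suc zero)    = ℕ.+-monoˡ-≤ _ (transmission≤ b v)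
transmission≤ (step b v _) (suc (suc x)) = ℕ.+-mono-≤ (transmission≤ b x) (2*suc-dist≤ b x v)

wiener≤ : ∀ {n A} (b : Built n A) → wienerℕ b ≤ maxWiener (size b)
wiener≤ base         = ℕ.≤-refl
wiener≤ (step b v _) = ℕ.+-mono-≤ (wiener≤ b)
  (ℕ.+-monoˡ-≤ 2 (ℕ.*-monoʳ-≤ 2 (ℕ.+-monoˡ-≤ _ (transmission≤ b v))))

+-tightʳ : ∀ {a b c d} → a ≤ c → b ≤ d → a +ⁿ b ≡ c +ⁿ d → b ≡ d
+-tightʳ {a} {b} {c} {d} a≤c b≤d eq = ℕ.≤-antisym b≤d
  (ℕ.+-cancelˡ-≤ c d b (subst (_≤ c +ⁿ b) eq (ℕ.+-monoˡ-≤ b a≤c)))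

-- Equality passes to each increment. For a new node the value at `v` must be maximal, and the node
-- far from `v` serves; for an old node the gain is maximal, so the new leaves themselves are far
-- from it.
transmission-max⇒far : ∀ {n A} (b : Built n A) x → transmissionℕ b x ≡ maxTransmission (size b) →
  ∃[ y ] dist b x y ≡ suc (size b)
transmission-max⇒far base zero             _ = suc zero , refl
transmission-max⇒far base (suc zero)       _ = zero , refl
transmission-max⇒far base (suc (suc zero)) _ = zero , refl
transmission-max⇒far (step b v _) zero       eq with transmission-max⇒far b v (ℕ.+-cancelʳ-≡ _ _ _ eq)
... | y , far = suc (suc y) , cong suc (trans (dist-sym b y v) far)
transmission-max⇒far (step b v _) (suc zero) eq with transmission-max⇒far b v (ℕ.+-cancelʳ-≡ _ _ _ eq)
... | y , far = suc (suc y) , cong suc (trans (dist-sym b y v) far)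
transmission-max⇒far (step b v _) (suc (suc x)) eq = zero ,
  ℕ.*-cancelˡ-≡ _ _ 2 (trans (+-tightʳ (transmission≤ b x) (2*suc-dist≤ b x v) eq) (sym (2*-suc (size b))))

Diametral : ∀ {n A} → Built n A → Set
Diametral b = ∃[ x ] ∃[ y ] dist b x y ≡ suc (size b)

wiener-max⇒diametral : ∀ {n A} (b : Built n A) → wienerℕ b ≡ maxWiener (size b) → Diametral b
wiener-max⇒diametral base         eq = zero , suc zero , refl
-- Equality in the second summand makes the transmission at `v` maximal, so some `y` is at distance
-- k + 1 from `v` and thus at distance k + 2 from a new leaf.
wiener-max⇒diametral (step b v _) eq with transmission-max⇒far b v
  (ℕ.+-cancelʳ-≡ (2 *ⁿ suc (size b)) _ _ (ℕ.*-cancelˡ-≡ _ _ 2 (ℕ.+-cancelʳ-≡ 2 _ _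
    (+-tightʳ (wiener≤ b) (ℕ.+-monoˡ-≤ 2 (ℕ.*-monoʳ-≤ 2 (ℕ.+-monoˡ-≤ _ (transmission≤ b v)))) eq))))
... | y , far = zero , suc (suc y) , cong suc (trans (dist-sym b y v) far)

-- Only a new node and an old node can be at distance k + 2 after the (k+1)-st step.
data FarStep {n A} (b : Built n A) (v : Fin n) : Fin (suc (suc n)) → Fin (suc (suc n)) → Set where
  new₀-old : ∀ z → dist b z v ≡ suc (size b) → FarStep b v zero (suc (suc z))
  new₁-old : ∀ z → dist b z v ≡ suc (size b) → FarStep b v (suc zero) (suc (suc z))
  old-new₀ : ∀ z → dist b z v ≡ suc (size b) → FarStep b v (suc (suc z)) zero
  old-new₁ : ∀ z → dist b z v ≡ suc (size b) → FarStep b v (suc (suc z)) (suc zero)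

1≤size : ∀ {n A} (b : Built n A) → 1 ≤ size b
1≤size base         = ℕ.≤-refl
1≤size (step b v _) = s≤s z≤n

farStep : ∀ {n A} (b : Built n A) v dv x y → dist (step b v dv) x y ≡ suc (suc (size b)) → FarStep b v x y
-- Two new leaves are at distance 2, which would be k + 2 only for k = 0.
farStep b v dv zero          (suc zero)    far = ⊥-elim (ℕ.<-irrefl (ℕ.suc-injective (ℕ.suc-injective far)) (1≤size b))
farStep b v dv (suc zero)    zero          far = ⊥-elim (ℕ.<-irrefl (ℕ.suc-injective (ℕ.suc-injective far)) (1≤size b))
farStep b v dv zero          (suc (suc y)) far = new₀-old y (ℕ.suc-injective far)
farStep b v dv (suc zero)    (suc (suc y)) far = new₁-old y (ℕ.suc-injective far)
farStep b v dv (suc (suc x)) zero          far = old-new₀ x (ℕ.suc-injective far)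
farStep b v dv (suc (suc x)) (suc zero)    far = old-new₁ x (ℕ.suc-injective far)
farStep b v dv (suc (suc x)) (suc (suc y)) far = ⊥-elim (ℕ.<-irrefl far (s≤s (dist≤ b x y)))

far⇒transmission-max : ∀ {n A} (b : Built n A) x y → dist b x y ≡ suc (size b) →
  transmissionℕ b x ≡ maxTransmission (size b)
far⇒transmission-max base x y far = refl
far⇒transmission-max (step b v dv) x y far with farStep b v dv x y far
... | new₀-old z far′ = cong (_+ⁿ _) (far⇒transmission-max b v z (trans (dist-sym b v z) far′))
... | new₁-old z far′ = cong (_+ⁿ _) (far⇒transmission-max b v z (trans (dist-sym b v z) far′))
... | old-new₀ z far′ = cong₂ _+ⁿ_ (far⇒transmission-max b z v far′) (trans (cong (λ d → 2 *ⁿ suc d) far′) (2*-suc (size b)))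
... | old-new₁ z far′ = cong₂ _+ⁿ_ (far⇒transmission-max b z v far′) (trans (cong (λ d → 2 *ⁿ suc d) far′) (2*-suc (size b)))

-- Needed for the graph whose clique graph is a path: it identifies the Wiener index that a
-- cospectral graph inherits as the maximum, so that the equality case applies to the latter. By
-- `farStep`, `v` is itself an end of a diametral pair of the old tree.
diametral⇒wiener-max : ∀ {n A} (b : Built n A) → Diametral b → wienerℕ b ≡ maxWiener (size b)
diametral⇒wiener-max base _ = refl
diametral⇒wiener-max (step b v dv) (x , y , far) = end (proj₂ (oldEnd (farStep b v dv x y far)))
  where
  oldEnd : ∀ {x y} → FarStep b v x y → ∃[ z ] dist b z v ≡ suc (size b)
  oldEnd (new₀-old z far′) = z , far′
  oldEnd (new₁-old z far′) = z , far′
  oldEnd (old-new₀ z far′) = z , far′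
  oldEnd (old-new₁ z far′) = z , far′
  end : ∀ {z} → dist b z v ≡ suc (size b) → wienerℕ (step b v dv) ≡ maxWiener (suc (size b))
  end {z} far′ = cong₂ (λ W s → W +ⁿ (2 *ⁿ (s +ⁿ 2 *ⁿ suc (size b)) +ⁿ 2))
    (diametral⇒wiener-max b (z , v , far′))
    (far⇒transmission-max b v z (trans (dist-sym b v z) far′))

-- Caterpillars

≅-refl : ∀ {n} {A : Adj n} → A ≅ A
≅-refl = Perm.id , λ _ _ → refl

≅-sym : ∀ {m n} {A : Adj m} {B : Adj n} → A ≅ B → B ≅ A
≅-sym {B = B} (f , iso) = flip f , λ u v →
  trans (sym (iso (f ⟨$⟩ˡ u) (f ⟨$⟩ˡ v))) (cong₂ B (inverseʳ f) (inverseʳ f))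

≅-trans : ∀ {l m n} {A : Adj l} {B : Adj m} {C : Adj n} → A ≅ B → B ≅ C → A ≅ C
≅-trans (f , iso) (g , iso′) = f ∘ₚ g , λ u v → trans (iso′ (f ⟨$⟩ʳ u) (f ⟨$⟩ʳ v)) (iso u v)

glue-cong : ∀ {m n} {A : Adj m} {B : Adj n} ((f , _) : A ≅ B) {u v} → f ⟨$⟩ʳ u ≡ v → glue A u ≅ glue B v
glue-cong {A = A} {B} (f , iso) {u} {v} fu≡v = lift₀ (lift₀ f) , adj
  where
  attached : ∀ x → ⌊ f ⟨$⟩ʳ x ≟ v ⌋ ≡ ⌊ x ≟ u ⌋
  attached x = trans (cong (λ z → ⌊ f ⟨$⟩ʳ x ≟ z ⌋) (sym fu≡v)) (sym (≟-permute f x u))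

  adj : ∀ x y → glue B v (lift₀ (lift₀ f) ⟨$⟩ʳ x) (lift₀ (lift₀ f) ⟨$⟩ʳ y) ≡ glue A u x y
  adj zero          zero          = refl
  adj zero          (suc zero)    = refl
  adj (suc zero)    zero          = refl
  adj (suc zero)    (suc zero)    = refl
  adj zero          (suc (suc y)) = attached y
  adj (suc zero)    (suc (suc y)) = attached y
  adj (suc (suc x)) zero          = attached x
  adj (suc (suc x)) (suc zero)    = attached x
  adj (suc (suc x)) (suc (suc y)) = iso x y

swap01-involutive : ∀ {n} (x : Fin (suc (suc n))) → swap01 (swap01 x) ≡ x
swap01-involutive zero          = refl
swap01-involutive (suc zero)    = refl
swap01-involutive (suc (suc x)) = refl

glue-swap01 : ∀ {n} (A : Adj n) v → glue A v ≅ glue A v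
glue-swap01 A v = permutation swap01 swap01 swap01-involutive swap01-involutive , λ where
  zero          zero          → refl
  zero          (suc zero)    → refl
  (suc zero)    zero          → refl
  (suc zero)    (suc zero)    → refl
  zero          (suc (suc y)) → refl
  (suc zero)    (suc (suc y)) → refl
  (suc (suc x)) zero          → refl
  (suc (suc x)) (suc zero)    → refl
  (suc (suc x)) (suc (suc y)) → refl

exchange : ∀ {n} → Fin (suc (suc (suc (suc n)))) → Fin (suc (suc (suc (suc n))))
exchange zero                      = suc (suc zero)
exchange (suc zero)                = suc (suc (suc zero))
exchange (suc (suc zero))          = zero
exchange (suc (suc (suc zero)))    = suc zero
exchange (suc (suc (suc (suc x)))) = suc (suc (suc (suc x)))

-- The case `u` = `v` is included: it occurs in the reversal of length 2, where the inner
-- caterpillar is a single vertex.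
glue-comm : ∀ {n} (A : Adj n) u v → glue (glue A u) (suc (suc v)) ≅ glue (glue A v) (suc (suc u))
glue-comm A u v = permutation exchange exchange invol invol , adj
  where
  invol : ∀ {n} (x : Fin (suc (suc (suc (suc n))))) → exchange (exchange x) ≡ x
  invol zero                      = refl
  invol (suc zero)                = refl
  invol (suc (suc zero))          = refl
  invol (suc (suc (suc zero)))    = refl
  invol (suc (suc (suc (suc x)))) = refl

  ss : ∀ {n} (x y : Fin n) → _
  ss x y = trans (≟-suc (suc x) (suc y)) (≟-suc x y)

  adj : ∀ x y → glue (glue A v) (suc (suc u)) (exchange x) (exchange y) ≡ glue (glue A u) (suc (suc v)) x y
  adj zero                      zero                      = refl
  adj zero                      (suc zero)                = refl
  adj zero                      (suc (suc zero))          = refl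
  adj zero                      (suc (suc (suc zero)))    = refl
  adj zero                      (suc (suc (suc (suc y)))) = sym (ss y v)
  adj (suc zero)                zero                      = refl
  adj (suc zero)                (suc zero)                = refl
  adj (suc zero)                (suc (suc zero))          = refl
  adj (suc zero)                (suc (suc (suc zero)))    = refl
  adj (suc zero)                (suc (suc (suc (suc y)))) = sym (ss y v)
  adj (suc (suc zero))          zero                      = refl
  adj (suc (suc zero))          (suc zero)                = refl
  adj (suc (suc zero))          (suc (suc zero))          = refl
  adj (suc (suc zero))          (suc (suc (suc zero)))    = refl
  adj (suc (suc zero))          (suc (suc (suc (suc y)))) = ss y u
  adj (suc (suc (suc zero)))    zero                      = refl
  adj (suc (suc (suc zero)))    (suc zero)                = refl
  adj (suc (suc (suc zero)))    (suc (suc zero))          = refl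
  adj (suc (suc (suc zero)))    (suc (suc (suc zero)))    = refl
  adj (suc (suc (suc zero)))    (suc (suc (suc (suc y)))) = ss y u
  adj (suc (suc (suc (suc x)))) zero                      = sym (ss x v)
  adj (suc (suc (suc (suc x)))) (suc zero)                = sym (ss x v)
  adj (suc (suc (suc (suc x)))) (suc (suc zero))          = ss x u
  adj (suc (suc (suc (suc x)))) (suc (suc (suc zero)))    = ss x u
  adj (suc (suc (suc (suc x)))) (suc (suc (suc (suc y)))) = refl

-- An isomorphism extends over a gluing only if it matches the vertices glued at, so the two ends
-- have to be carried along in the inductions.
record Bipointed : Set where
  constructor bipointed
  field
    {order}   : ℕ
    graph     : Adj order
    start end : Fin order

open Bipointed

record _≅₂_ (P Q : Bipointed) : Set where
  constructor ⟨_,_,_⟩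
  field
    iso     : graph P ≅ graph Q
    start-↦ : proj₁ iso ⟨$⟩ʳ start P ≡ start Q
    end-↦   : proj₁ iso ⟨$⟩ʳ end P ≡ end Q

infixr 5 _⨾_

_⨾_ : ∀ {P Q R} → P ≅₂ Q → Q ≅₂ R → P ≅₂ R
_⨾_ {P} {Q} {R} ⟨ F , p , q ⟩ ⟨ G@(g , _) , r , s ⟩ =
  ⟨ ≅-trans {A = graph P} {graph Q} {graph R} F G , trans (cong (g ⟨$⟩ʳ_) p) r , trans (cong (g ⟨$⟩ʳ_) q) s ⟩

flip₂ : ∀ {m n} {A : Adj m} {B : Adj n} {x y x′ y′} →
  bipointed A x y ≅₂ bipointed B x′ y′ → bipointed A y x ≅₂ bipointed B y′ x′
flip₂ ⟨ F , p , q ⟩ = ⟨ F , q , p ⟩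

vertices : ℕ → ℕ
vertices zero    = 1
vertices (suc k) = suc (suc (vertices k))

front back : ∀ k → Fin (vertices k)
front zero    = zero
front (suc k) = zero
back zero    = zero
back (suc k) = suc (suc (back k))

-- The recursion starts at one vertex, the line graph of a single edge, where both ends coincide;
-- `caterpillar 1` is then the triangle, and `reversal` can descend by two.
caterpillar : ∀ k → Adj (vertices k)
caterpillar zero    _ _ = false
caterpillar (suc k)     = glue (caterpillar k) (front k)

forward backward : ℕ → Bipointed
forward  k = bipointed (caterpillar k) (front k) (back k)
backward k = bipointed (caterpillar k) (back k) (front k)

-- Exchanging the last two gluings at opposite ends reduces the reversal of length k + 2
-- to those of lengths k + 1 and k.
reversal : ∀ k → forward k ≅₂ backward k
reversal zero = ⟨ ≅-refl , refl , refl ⟩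
reversal (suc zero) = ⟨ (permutation r r invol invol , adj) , refl , refl ⟩
  where
  r : Fin 3 → Fin 3
  r zero             = suc (suc zero)
  r (suc zero)       = suc zero
  r (suc (suc zero)) = zero
  invol : ∀ x → r (r x) ≡ x
  invol zero             = refl
  invol (suc zero)       = refl
  invol (suc (suc zero)) = refl
  adj : ∀ x y → caterpillar 1 (r x) (r y) ≡ caterpillar 1 x y
  adj zero             zero             = refl
  adj zero             (suc zero)       = refl
  adj zero             (suc (suc zero)) = refl
  adj (suc zero)       zero             = refl
  adj (suc zero)       (suc zero)       = refl
  adj (suc zero)       (suc (suc zero)) = refl
  adj (suc (suc zero)) zero             = refl
  adj (suc (suc zero)) (suc zero)       = refl
  adj (suc (suc zero)) (suc (suc zero)) = refl
reversal (suc (suc k)) with reversal k | reversal (suc k)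
... | ⟨ F , fe , ff ⟩ | ⟨ G , ge , gf ⟩ = α ⨾ β ⨾ γ ⨾ η
  where
  C = caterpillar k
  e = front k
  f = back k
  -- `α` reverses the inner k + 1 triangles, which moves the last gluing to their back; `β`
  -- exchanges the last two gluings; `γ` reverses the inner k triangles; `η` reverses k + 1
  -- triangles again.
  α : forward (suc (suc k)) ≅₂ bipointed (glue (glue C e) (suc (suc f))) zero (suc (suc zero))
  α = ⟨ glue-cong G ge , refl , cong (λ x → suc (suc x)) gf ⟩
  β : bipointed (glue (glue C e) (suc (suc f))) zero (suc (suc zero)) ≅₂ bipointed (glue (glue C f) (suc (suc e))) (suc (suc zero)) zero
  β = ⟨ glue-comm C e f , refl , refl ⟩
  γ : bipointed (glue (glue C f) (suc (suc e))) (suc (suc zero)) zero ≅₂ bipointed (glue (glue C e) (suc (suc f))) (suc (suc zero)) zero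
  γ = ⟨ glue-cong (glue-cong F ff) (cong (λ x → suc (suc x)) fe) , refl , refl ⟩
  η : bipointed (glue (glue C e) (suc (suc f))) (suc (suc zero)) zero ≅₂ backward (suc (suc k))
  η = ⟨ glue-cong G gf , cong (λ x → suc (suc x)) ge , refl ⟩

-- One end of a far pair is a new vertex and the other is far from `v` in the old tree. By induction
-- `v` corresponds to the front of the smaller caterpillar, which is where the next triangle of the
-- caterpillar is glued. Swapping the new vertices and reversing cover the other orientations.
far⇒forward : ∀ {n A} (b : Built n A) x y → dist b x y ≡ suc (size b) → bipointed A x y ≅₂ forward (size b)
far⇒forward base x y far = toCaterpillar ⨾ orient x y far
  where
  toCaterpillar : bipointed triangle x y ≅₂ bipointed (caterpillar 1) x y
  toCaterpillar = ⟨ (Perm.id , adj) , refl , refl ⟩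
    where
    adj : ∀ x y → caterpillar 1 x y ≡ triangle x y
    adj zero             zero             = refl
    adj zero             (suc zero)       = refl
    adj zero             (suc (suc zero)) = refl
    adj (suc zero)       zero             = refl
    adj (suc zero)       (suc zero)       = refl
    adj (suc zero)       (suc (suc zero)) = refl
    adj (suc (suc zero)) zero             = refl
    adj (suc (suc zero)) (suc zero)       = refl
    adj (suc (suc zero)) (suc (suc zero)) = refl

  swapped : ∀ x y → bipointed (caterpillar 1) x y ≅₂ bipointed (caterpillar 1) (swap01 x) (swap01 y)
  swapped x y = ⟨ glue-swap01 (caterpillar 0) zero , refl , refl ⟩

  orient : ∀ x y → dist base x y ≡ 2 → bipointed (caterpillar 1) x y ≅₂ forward 1
  orient zero             (suc (suc zero)) _ = ⟨ ≅-refl , refl , refl ⟩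
  orient (suc zero)       (suc (suc zero)) _ = swapped (suc zero) (suc (suc zero))
  orient (suc (suc zero)) zero             _ = flip₂ (reversal 1)
  orient (suc (suc zero)) (suc zero)       _ = swapped (suc (suc zero)) (suc zero) ⨾ flip₂ (reversal 1)
  orient zero             (suc zero)       _ = swapped zero (suc zero) ⨾
    ⟨ _≅₂_.iso (reversal 1) , refl , refl ⟩ ⨾ swapped (suc zero) (suc (suc zero))
  orient (suc zero)       zero             _ =
    ⟨ _≅₂_.iso (reversal 1) , refl , refl ⟩ ⨾ swapped (suc zero) (suc (suc zero))
  orient (suc (suc zero)) (suc (suc zero)) ()
far⇒forward (step {A = A} b v dv) x y far = orient (farStep b v dv x y far)
  where
  extend : ∀ z → dist b z v ≡ suc (size b) → bipointed (glue A v) zero (suc (suc z)) ≅₂ forward (suc (size b))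
  extend z far′ with far⇒forward b v z (trans (dist-sym b v z) far′)
  ... | ⟨ F , p , q ⟩ = ⟨ glue-cong F p , refl , cong (λ x → suc (suc x)) q ⟩

  swapped : ∀ z → bipointed (glue A v) (suc zero) (suc (suc z)) ≅₂ bipointed (glue A v) zero (suc (suc z))
  swapped z = ⟨ glue-swap01 A v , refl , refl ⟩

  orient : ∀ {x y} → FarStep b v x y → bipointed (glue A v) x y ≅₂ forward (suc (size b))
  orient (new₀-old z far′) = extend z far′
  orient (new₁-old z far′) = swapped z ⨾ extend z far′
  orient (old-new₀ z far′) = flip₂ (extend z far′ ⨾ reversal (suc (size b)))
  orient (old-new₁ z far′) = flip₂ (swapped z ⨾ extend z far′ ⨾ reversal (suc (size b)))

diametral⇒caterpillar : ∀ {n A} (b : Built n A) → Diametral b → A ≅ caterpillar (size b)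
diametral⇒caterpillar b (x , y , far) = _≅₂_.iso (far⇒forward b x y far)

-- Clique graphs that are paths

≟-true : ∀ {n} {u v : Fin n} → ⌊ u ≟ v ⌋ ≡ true → u ≡ v
≟-true {u = u} {v} eq with u ≟ v
... | yes u≡v = u≡v
≟-true () | no _

mem : ∀ {n A} (b : Built n A) → Fin (size b) → Fin n → Bool
mem base         _       _             = true
mem (step b v _) zero    zero          = true
mem (step b v _) zero    (suc zero)    = true
mem (step b v _) zero    (suc (suc u)) = ⌊ u ≟ v ⌋
mem (step b v _) (suc j) zero          = false
mem (step b v _) (suc j) (suc zero)    = false
mem (step b v _) (suc j) (suc (suc u)) = mem b j u

mem-covers : ∀ {n A} (b : Built n A) x → ∃[ j ] mem b j x ≡ true
mem-covers base x = zero , refl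
mem-covers (step b v _) zero          = zero , refl
mem-covers (step b v _) (suc zero)    = zero , refl
mem-covers (step b v _) (suc (suc u)) with mem-covers b u
... | j , u∈j = suc j , u∈j

mem-injective : ∀ {n A} (b : Built n A) i j → (∀ x → mem b i x ≡ mem b j x) → i ≡ j
mem-injective base zero zero _ = refl
mem-injective (step b v _) zero    zero    _ = refl
mem-injective (step b v _) zero    (suc j) eq with eq zero
... | ()
mem-injective (step b v _) (suc i) zero    eq with eq zero
... | ()
mem-injective (step b v _) (suc i) (suc j) eq = cong suc (mem-injective b i j λ x → eq (suc (suc x)))

mem-clique : ∀ {n A} (b : Built n A) j x y → mem b j x ≡ true → mem b j y ≡ true → x ≢ y → A x y ≡ true
mem-clique base j x y _ _ x≢y = cong (if_then false else true) (≟-≢ x≢y)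
mem-clique (step b v _) zero zero          zero          _ _ x≢y = ⊥-elim (x≢y refl)
mem-clique (step b v _) zero zero          (suc zero)    _ _ _ = refl
mem-clique (step b v _) zero (suc zero)    zero          _ _ _ = refl
mem-clique (step b v _) zero (suc zero)    (suc zero)    _ _ x≢y = ⊥-elim (x≢y refl)
mem-clique (step b v _) zero zero          (suc (suc y)) _ q _ = q
mem-clique (step b v _) zero (suc zero)    (suc (suc y)) _ q _ = q
mem-clique (step b v _) zero (suc (suc x)) zero          p _ _ = p
mem-clique (step b v _) zero (suc (suc x)) (suc zero)    p _ _ = p
mem-clique (step b v _) zero (suc (suc x)) (suc (suc y)) p q x≢y =
  ⊥-elim (x≢y (cong (λ u → suc (suc u)) (trans (≟-true p) (sym (≟-true q)))))
mem-clique (step b v _) (suc j) (suc (suc x)) (suc (suc y)) p q x≢y =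
  mem-clique b j x y p q (x≢y ∘ cong (λ u → suc (suc u)))

-- Keeps old triangles maximal: a new vertex has `v` as its only old neighbour, so it cannot be
-- adjacent to two distinct old vertices.
mem-two : ∀ {n A} (b : Built n A) j → ∃[ x ] ∃[ y ] (x ≢ y × mem b j x ≡ true × mem b j y ≡ true)
mem-two base         j       = zero , suc zero , (λ ()) , refl , refl
mem-two (step b v _) zero    = zero , suc zero , (λ ()) , refl , refl
mem-two (step b v _) (suc j) with mem-two b j
... | x , y , x≢y , x∈j , y∈j = suc (suc x) , suc (suc y) , x≢y ∘ suc-injective ∘ suc-injective , x∈j , y∈j

mem-maximal : ∀ {n A} (b : Built n A) j w →
  (∀ u → mem b j u ≡ true → w ≢ u → A w u ≡ true) → mem b j w ≡ true
mem-maximal base j w _ = refl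
mem-maximal (step b v _) zero zero          _   = refl
mem-maximal (step b v _) zero (suc zero)    _   = refl
mem-maximal (step b v _) zero (suc (suc w)) adj = adj zero refl λ ()
mem-maximal (step b v _) (suc j) zero adj with mem-two b j
... | x , y , x≢y , x∈j , y∈j = ⊥-elim (x≢y (trans
  (≟-true (adj (suc (suc x)) x∈j λ ())) (sym (≟-true (adj (suc (suc y)) y∈j λ ())))))
mem-maximal (step b v _) (suc j) (suc zero) adj with mem-two b j
... | x , y , x≢y , x∈j , y∈j = ⊥-elim (x≢y (trans
  (≟-true (adj (suc (suc x)) x∈j λ ())) (sym (≟-true (adj (suc (suc y)) y∈j λ ())))))
mem-maximal (step b v _) (suc j) (suc (suc w)) adj =
  mem-maximal b j w λ u u∈j w≢u → adj (suc (suc u)) u∈j (w≢u ∘ suc-injective ∘ suc-injective)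

Consecutive : ℕ → ℕ → Set
Consecutive p q = q ≡ suc p ⊎ p ≡ suc q

-- π plays the role of the position of a triangle in the path K(G).
record Placement {n A} (b : Built n A) (π : Fin (size b) → ℕ) : Set where
  field
    injective : ∀ i j → π i ≡ π j → i ≡ j
    meet      : ∀ i j x → i ≢ j → mem b i x ≡ true → mem b j x ≡ true → Consecutive (π i) (π j)

placement-old : ∀ {n A} {b : Built n A} {v dv π} → Placement (step b v dv) π → Placement b (π ∘ suc)
placement-old P = record
  { injective = λ i j eq → suc-injective (injective (suc i) (suc j) eq)
  ; meet      = λ i j x i≢j → meet (suc i) (suc j) (suc (suc x)) (i≢j ∘ suc-injective)
  }
  where open Placement P

-- The triangles glued so far fill some stretch of the path, not necessarily one starting at 0,
-- hence the free lower bound. The upper bound is exclusive, which avoids subtraction.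
record Interval {k} (π : Fin k → ℕ) (s t : Fin k) : Set where
  field
    lo     : ℕ
    first  : π s ≡ lo
    last   : suc (π t) ≡ lo +ⁿ k
    lower  : ∀ j → lo ≤ π j
    upper  : ∀ j → π j < lo +ⁿ k
    onto   : ∀ p → lo ≤ p → p < lo +ⁿ k → ∃[ j ] π j ≡ p

-- Triangles s and t whose leaves lie at the two ends of a longest path of S.
record Tips {n A} (b : Built n A) (s t : Fin (size b)) : Set where
  field
    far   : ∀ x y → mem b s x ≡ true → mem b t y ≡ true → deg A x ≡ 2 → deg A y ≡ 2 → x ≢ y →
            dist b x y ≡ suc (size b)
    leafₛ : ∃[ x ] (mem b s x ≡ true × deg A x ≡ 2)
    toₜ   : ∀ x → mem b s x ≡ true → deg A x ≡ 2 → ∃[ y ] (mem b t y ≡ true × deg A y ≡ 2 × x ≢ y)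
    toₛ   : ∀ y → mem b t y ≡ true → deg A y ≡ 2 → ∃[ x ] (mem b s x ≡ true × deg A x ≡ 2 × y ≢ x)

tips-swap : ∀ {n A} {b : Built n A} {s t} → Tips b s t → Tips b t s
tips-swap {b = b} T = record
  { far   = λ x y x∈t y∈s dx dy x≢y → trans (dist-sym b x y) (far y x y∈s x∈t dy dx (x≢y ∘ sym))
  ; leafₛ = let x , x∈s , dx = leafₛ ; y , y∈t , dy , _ = toₜ x x∈s dx in y , y∈t , dy
  ; toₜ   = toₛ
  ; toₛ   = toₜ
  }
  where open Tips T

tips-base : Tips base zero zero
tips-base = record
  { far   = λ x y _ _ _ _ x≢y → cong (if_then 0 else 2) (≟-≢ x≢y)
  ; leafₛ = zero , refl , refl
  ; toₜ   = λ x _ _ → other x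
  ; toₛ   = λ x _ _ → other x
  }
  where
  other : ∀ x → ∃[ y ] (true ≡ true × deg triangle y ≡ 2 × x ≢ y)
  other zero    = suc zero , refl , refl , λ ()
  other (suc x) = zero , refl , refl , λ ()

-- Having degree 2 in `A`, the vertex `v` is a leaf of the old tip `s`, so the other leaves in `t`
-- are at distance k + 1 from it and at k + 2 from the new ones. The inequality in `toₜ` provides a
-- leaf of `t` that survives the gluing even when `s` and `t` are the same triangle.
tips-step : ∀ {n A} {b : Built n A} {s t v} dv → Tips b s t → mem b s v ≡ true → Tips (step b v dv) zero (suc t)
tips-step {n} {A} {b} {s} {t} {v} dv T v∈s = record
  { far   = far′
  ; leafₛ = zero , refl , deg-new₀ A v
  ; toₜ   = toₜ′
  ; toₛ   = toₛ′
  }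
  where
  open Tips T
  b′ = step b v dv

  not-v : ∀ u → mem b′ zero (suc (suc u)) ≡ true → deg (glue A v) (suc (suc u)) ≡ 2 → ⊥
  not-v u u∈0 du = proj₁ (leaf-old A u v dv du) (≟-true u∈0)

  far-v : ∀ z → mem b t z ≡ true → deg (glue A v) (suc (suc z)) ≡ 2 → suc (dist b z v) ≡ suc (suc (size b))
  far-v z z∈t dz with leaf-old A z v dv dz
  ... | z≢v , dz′ = cong suc (trans (dist-sym b z v) (far v z v∈s z∈t dv dz′ (z≢v ∘ sym)))

  far′ : ∀ x y → mem b′ zero x ≡ true → mem b′ (suc t) y ≡ true → deg (glue A v) x ≡ 2 → deg (glue A v) y ≡ 2 →
         x ≢ y → dist b′ x y ≡ suc (size b′)
  far′ zero          (suc (suc z)) _ z∈t _ dz _ = far-v z z∈t dz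
  far′ (suc zero)    (suc (suc z)) _ z∈t _ dz _ = far-v z z∈t dz
  far′ (suc (suc u)) _ u∈0 _ du _ _ = ⊥-elim (not-v u u∈0 du)

  toₜ′ : ∀ x → mem b′ zero x ≡ true → deg (glue A v) x ≡ 2 →
    ∃[ y ] (mem b′ (suc t) y ≡ true × deg (glue A v) y ≡ 2 × x ≢ y)
  toₜ′ x x∈0 dx with toₜ v v∈s dv
  ... | y , y∈t , dy , v≢y = suc (suc y) , y∈t , trans (deg-old A (v≢y ∘ sym)) dy , x≢ x x∈0 dx
    where
    x≢ : ∀ x → mem b′ zero x ≡ true → deg (glue A v) x ≡ 2 → x ≢ suc (suc y)
    x≢ (suc (suc u)) u∈0 du _ = not-v u u∈0 du

  toₛ′ : ∀ y → mem b′ (suc t) y ≡ true → deg (glue A v) y ≡ 2 →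
    ∃[ x ] (mem b′ zero x ≡ true × deg (glue A v) x ≡ 2 × y ≢ x)
  toₛ′ (suc (suc y)) _ _ = zero , refl , deg-new₀ A v , λ ()

-- The old triangles fill an interval by induction. The new one shares `v` with an old triangle `i`,
-- so its position is free but next to an occupied one: it lies just outside the interval, and `i`
-- is the tip at that end. Hence every triangle is glued to a tip and no branching arises.
placement⇒ends : ∀ {n A} (b : Built n A) π → Placement b π → ∃[ s ] ∃[ t ] (Interval π s t × Tips b s t)
placement⇒ends base π P = zero , zero , record
  { lo = π zero ; first = refl ; last = ℕ.+-comm 1 (π zero)
  ; lower = λ { zero → ℕ.≤-refl } ; upper = λ { zero → ℕ.m<m+n (π zero) (s≤s z≤n) }
  ; onto = λ p lo≤p p<hi → zero , ℕ.≤-antisym lo≤p (ℕ.≤-pred (subst (p <_) (ℕ.+-comm (π zero) 1) p<hi))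
  } , tips-base
placement⇒ends (step b v dv) π P with mem-covers b v | placement⇒ends b (π ∘ suc) (placement-old P)
... | i , v∈i | s , t , I , T = attach (meet zero (suc i) (suc (suc v)) (λ ()) (≟-refl v) v∈i)
  where
  open Placement P
  open Interval I
  k = size b

  fresh : ∀ j → π (suc j) ≢ π zero
  fresh j eq with injective (suc j) zero eq
  ... | ()

  attach : Consecutive (π zero) (π (suc i)) → ∃[ s′ ] ∃[ t′ ] (Interval π s′ t′ × Tips (step b v dv) s′ t′)
  attach (inj₁ below) = zero , suc t , record
    { lo    = π zero
    ; first = refl
    ; last  = trans last hi≡
    ; lower = λ { zero → ℕ.≤-refl ; (suc j) → ℕ.≤-trans (ℕ.<⇒≤ p<lo) (lower j) }
    ; upper = λ { zero → ℕ.m<m+n (π zero) (s≤s z≤n) ; (suc j) → subst (π (suc j) <_) hi≡ (upper j) }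
    ; onto  = onto′
    } , tips-step dv T (subst (λ j → mem b j v ≡ true) i≡s v∈i)
    where
    p<lo : π zero < lo
    p<lo = ℕ.≰⇒> λ lo≤p →
      let j , eq = onto (π zero) lo≤p (ℕ.≤-trans (ℕ.≤-reflexive (sym below)) (ℕ.<⇒≤ (upper i))) in fresh j eq
    lo≡ : lo ≡ suc (π zero)
    lo≡ = ℕ.≤-antisym (subst (lo ≤_) below (lower i)) p<lo
    hi≡ : lo +ⁿ k ≡ π zero +ⁿ suc k
    hi≡ = trans (cong (_+ⁿ k) lo≡) (sym (ℕ.+-suc (π zero) k))
    i≡s : i ≡ s
    i≡s = suc-injective (injective (suc i) (suc s) (trans below (trans (sym lo≡) (sym first))))
    onto′ : ∀ q → π zero ≤ q → q < π zero +ⁿ suc k → ∃[ j ] π j ≡ q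
    onto′ q p≤q q<hi with ℕ.m≤n⇒m<n∨m≡n p≤q
    ... | inj₂ p≡q = zero , p≡q
    ... | inj₁ p<q = let j , eq = onto q (subst (_≤ q) (sym lo≡) p<q) (subst (q <_) (sym hi≡) q<hi) in suc j , eq
  attach (inj₂ above) = suc s , zero , record
    { lo    = lo
    ; first = first
    ; last  = trans (cong suc p≡) (sym (ℕ.+-suc lo k))
    ; lower = λ { zero → ℕ.≤-trans (ℕ.m≤m+n lo k) hi≤p ; (suc j) → lower j }
    ; upper = λ { zero → subst (π zero <_) (sym (ℕ.+-suc lo k)) (s≤s (ℕ.≤-reflexive p≡))
                ; (suc j) → ℕ.≤-trans (upper j) (ℕ.+-monoʳ-≤ lo (ℕ.n≤1+n k)) }
    ; onto  = onto′
    -- `tips-step` extends at the first tip, so an extension at the upper end is obtained by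
    -- exchanging the tips before and after.
    } , tips-swap (tips-step dv (tips-swap T) (subst (λ j → mem b j v ≡ true) i≡t v∈i))
    where
    hi≤p : lo +ⁿ k ≤ π zero
    hi≤p = ℕ.≮⇒≥ λ p<hi →
      let j , eq = onto (π zero) (ℕ.≤-trans (lower i) (subst (π (suc i) ≤_) (sym above) (ℕ.n≤1+n (π (suc i))))) p<hi in fresh j eq
    p≡ : π zero ≡ lo +ⁿ k
    p≡ = ℕ.≤-antisym (subst (_≤ lo +ⁿ k) (sym above) (upper i)) hi≤p
    i≡t : i ≡ t
    i≡t = suc-injective (injective (suc i) (suc t) (ℕ.suc-injective (trans (sym above) (trans p≡ (sym last)))))
    onto′ : ∀ q → lo ≤ q → q < lo +ⁿ suc k → ∃[ j ] π j ≡ q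
    onto′ q lo≤q q<hi with ℕ.m≤n⇒m<n∨m≡n (ℕ.≤-pred (subst (q <_) (ℕ.+-suc lo k) q<hi))
    ... | inj₁ q<    = let j , eq = onto q lo≤q q< in suc j , eq
    ... | inj₂ q≡hi = zero , trans p≡ (sym q≡hi)

placement⇒diametral : ∀ {n A} (b : Built n A) π → Placement b π → Diametral b
placement⇒diametral b π P =
  let _ , _ , _ , T = placement⇒ends b π P
      open Tips T
      x , x∈s , dx = leafₛ
      y , y∈t , dy , x≢y = toₜ x x∈s dx
  in x , y , far x y x∈s y∈t dx dy x≢y

-- From the maximal cliques of a graph isomorphic to a built one to a placement

module _ {m n : ℕ} {A : Adj m} {H : Adj n} (b : Built m A)
         (f : Permutation m n) (iso : ∀ u v → H (f ⟨$⟩ʳ u) (f ⟨$⟩ʳ v) ≡ A u v) where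

  triangleSet : Fin (size b) → Subset n
  triangleSet j = tabulate λ u → mem b j (f ⟨$⟩ˡ u)

  ∈-triangleSet⁻ : ∀ j u → u ∈ triangleSet j → mem b j (f ⟨$⟩ˡ u) ≡ true
  ∈-triangleSet⁻ j u u∈ = trans (sym (lookup∘tabulate (λ u → mem b j (f ⟨$⟩ˡ u)) u)) ([]=⇒lookup u∈)

  ∈-triangleSet⁺ : ∀ j u → mem b j (f ⟨$⟩ˡ u) ≡ true → u ∈ triangleSet j
  ∈-triangleSet⁺ j u u∈ = lookup⇒[]= u (triangleSet j) (trans (lookup∘tabulate (λ u → mem b j (f ⟨$⟩ˡ u)) u) u∈)

  ∈-triangleSet-to : ∀ j x → mem b j x ≡ true → f ⟨$⟩ʳ x ∈ triangleSet j
  ∈-triangleSet-to j x x∈ = ∈-triangleSet⁺ j (f ⟨$⟩ʳ x) (trans (cong (mem b j) (inverseˡ f)) x∈)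

  triangleSet-injective : ∀ i j → triangleSet i ≡ triangleSet j → i ≡ j
  triangleSet-injective i j eq = mem-injective b i j λ x → trans (sym (at i x)) (trans (cong (λ S → lookup S (f ⟨$⟩ʳ x)) eq) (at j x))
    where
    at : ∀ j x → lookup (triangleSet j) (f ⟨$⟩ʳ x) ≡ mem b j x
    at j x = trans (lookup∘tabulate (λ u → mem b j (f ⟨$⟩ˡ u)) (f ⟨$⟩ʳ x)) (cong (mem b j) (inverseˡ f))

  triangleSet-maximal : ∀ j → IsMaxClique H (triangleSet j)
  triangleSet-maximal j = clique , maximal
    where
    clique : IsClique H (triangleSet j)
    clique u v u∈ v∈ u≢v = trans (sym (proj₂ (≅-sym {A = A} {H} (f , iso)) u v))
      (mem-clique b j (f ⟨$⟩ˡ u) (f ⟨$⟩ˡ v) (∈-triangleSet⁻ j u u∈) (∈-triangleSet⁻ j v v∈)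
        λ eq → u≢v (trans (sym (inverseʳ f)) (trans (cong (f ⟨$⟩ʳ_) eq) (inverseʳ f))))

    maximal : ∀ S → IsClique H S → triangleSet j ⊆ S → S ⊆ triangleSet j
    maximal S S-clique T⊆S {w} w∈S = ∈-triangleSet⁺ j w (mem-maximal b j (f ⟨$⟩ˡ w) λ u u∈j w≢u → begin
      A (f ⟨$⟩ˡ w) u                     ≡⟨ sym (iso (f ⟨$⟩ˡ w) u) ⟩
      H (f ⟨$⟩ʳ (f ⟨$⟩ˡ w)) (f ⟨$⟩ʳ u)   ≡⟨ cong (λ z → H z (f ⟨$⟩ʳ u)) (inverseʳ f) ⟩
      H w (f ⟨$⟩ʳ u)
        ≡⟨ S-clique w (f ⟨$⟩ʳ u) w∈S (T⊆S (∈-triangleSet-to j u u∈j))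
             (λ eq → w≢u (trans (cong (f ⟨$⟩ˡ_) eq) (inverseˡ f))) ⟩
      true ∎)

  -- Each glued triangle is a maximal clique of `H`, so the surjectivity of the enumeration gives it
  -- a position on the path. Distinct triangles get distinct positions, and a common vertex forces
  -- adjacent ones.
  cliquePath⇒diametral : ∀ {k} → CliqueGraphIsoPath H k → Diametral b
  cliquePath⇒diametral {k} (F , _ , _ , onto , edges) = placement⇒diametral b (toℕ ∘ position) record
    { injective = λ i j → position-injective i j ∘ toℕ-injective
    ; meet      = λ i j x i≢j x∈i x∈j →
        proj₁ (edges (position i) (position j) (i≢j ∘ position-injective i j))
          (f ⟨$⟩ʳ x , placed i x x∈i , placed j x x∈j)
    }
    where
    position : Fin (size b) → Fin k
    position j = proj₁ (onto (triangleSet j) (triangleSet-maximal j))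

    F-position : ∀ j → F (position j) ≡ triangleSet j
    F-position j = proj₂ (onto (triangleSet j) (triangleSet-maximal j))

    position-injective : ∀ i j → position i ≡ position j → i ≡ j
    position-injective i j eq =
      triangleSet-injective i j (trans (sym (F-position i)) (trans (cong F eq) (F-position j)))

    placed : ∀ j x → mem b j x ≡ true → f ⟨$⟩ʳ x ∈ F (position j)
    placed j x x∈j = subst (f ⟨$⟩ʳ x ∈_) (sym (F-position j)) (∈-triangleSet-to j x x∈j)

theorem4 : (k : ℕ) → k ≥ 1 →
    (nH : ℕ) (H : Adj nH) → In𝒯 nH H → CliqueGraphIsoPath H k →
    (nG : ℕ) (G : Adj nG) → In𝒯 nG G → Cospectral G H →
    G ≅ H
theorem4 k _ nH H (_ , H′ , h , H′≅H) path nG G (_ , G′ , g , G′≅G) cosp =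
  ≅-trans {A = G} {G′} {H} (≅-sym {A = G′} {G} G′≅G) (≅-trans {A = G′} {caterpillar (size h)} {H}
    (subst (λ k → G′ ≅ caterpillar k) size≡ (diametral⇒caterpillar g (wiener-max⇒diametral g maxG)))
    (≅-trans {A = caterpillar (size h)} {H′} {H} (≅-sym {A = H′} {caterpillar (size h)} (diametral⇒caterpillar h diamH)) H′≅H))
  where
  diamH : Diametral h
  diamH = cliquePath⇒diametral h (proj₁ H′≅H) (proj₂ H′≅H) path

  invariants : size g ≡ size h × wienerℕ g ≡ wienerℕ h
  invariants = cospectral⇒size,wiener g h λ t →
    trans (charPoly-≅ {A = G′} {G} G′≅G t) (trans (cosp t) (sym (charPoly-≅ {A = H′} {H} H′≅H t)))

  size≡ : size g ≡ size h
  size≡ = proj₁ invariants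

  -- The value passes from `g` to `h` by cospectrality, is maximal for `h` because of its diametral
  -- pair, and equal sizes give the same maximum.
  maxG : wienerℕ g ≡ maxWiener (size g)
  maxG = trans (proj₂ invariants) (trans (diametral⇒wiener-max h diamH) (cong maxWiener (sym size≡)))
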